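{- Let $G$ be a graph on $n$ vertices, where $n=20$ or $n=21$, with exactly $2n-1$ edges and maximum vertex degree at most four. Then $\mathcal{E}(G)<2(n-1)$.
   Context: All graphs are finite, simple and undirected. The energy $\mathcal{E}(G)$ of a graph $G$ is the sum of the absolute values of the eigenvalues of its adjacency matrix. -}

module Defs where

open import Level using (0ℓ)
open import Algebra.Bundles.Raw using (RawRing)
import Algebra.Definitions.RawMonoid as RawMonoidDefs
open import Data.Bool.Base using (Bool; false; _∧_; if_then_else_)
open import Data.Fin.Base as Fin using (Fin; punchIn; toℕ)
open import Data.Fin.Properties using () renaming (_≟_ to _≟ᶠ_)
open import Data.Fin.Subset using (Subset; ∣_∣)
open import Data.Integer.Base using (+_)
open import Data.Nat.Base as ℕ using (ℕ; _⊔_; _<ᵇ_)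
import Data.Nat.Properties as ℕₚ
open import Data.Product.Base using (∃; _×_; _,_)
open import Data.Rational.Base as ℚ using (ℚ; 0ℚ; 1ℚ; ½)
import Data.Rational.Properties as ℚₚ
open import Data.Rational.Solver using (module +-*-Solver)
open import Data.Sum.Base using (inj₁; inj₂)
open import Data.Vec.Base using (tabulate)
open import Data.Vec.Functional as Vector using (Vector)
open import Relation.Binary.PropositionalEquality
  using (_≡_; refl; sym; trans; cong; subst)
open import Relation.Nullary.Decidable.Core using (does)

------------------------------------------------------------------------
-- Real numbers: Cauchy sequences of rationals, each carrying a modulus of
-- convergence, up to the equivalence _≃_.

IsCauchy : (ℕ → ℚ) → Set
IsCauchy s = ∀ (ε : ℚ) → 0ℚ ℚ.< ε →
  ∃ λ N → ∀ m n → N ℕ.≤ m → N ℕ.≤ n → ℚ.∣ s m ℚ.- s n ∣ ℚ.< ε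

record ℝ : Set where
  constructor mkℝ
  field
    seq    : ℕ → ℚ
    cauchy : IsCauchy seq

open ℝ public

infix 4 _≃_ _<ℝ_

record _≃_ (x y : ℝ) : Set where
  constructor mk≃
  field
    close : ∀ (ε : ℚ) → 0ℚ ℚ.< ε →
      ∃ λ N → ∀ n → N ℕ.≤ n → ℚ.∣ seq x n ℚ.- seq y n ∣ ℚ.< ε

-- The gap ε must be uniform in n: the termwise order would not
-- respect _≃_.
_<ℝ_ : ℝ → ℝ → Set
x <ℝ y = ∃ λ (ε : ℚ) → 0ℚ ℚ.< ε ×
  ∃ λ N → ∀ n → N ℕ.≤ n → seq x n ℚ.+ ε ℚ.≤ seq y n

private
  abstract
    sum-difference : ∀ a b c d →
      (a ℚ.+ b) ℚ.- (c ℚ.+ d) ≡ (a ℚ.- c) ℚ.+ (b ℚ.- d)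
    sum-difference = solve 4
      (λ a b c d → ((a :+ b) :- (c :+ d)) := ((a :- c) :+ (b :- d))) refl
      where open +-*-Solver

    product-difference : ∀ a b c d →
      a ℚ.* b ℚ.- c ℚ.* d ≡ a ℚ.* (b ℚ.- d) ℚ.+ d ℚ.* (a ℚ.- c)
    product-difference = solve 4
      (λ a b c d → ((a :* b) :- (c :* d)) := ((a :* (b :- d)) :+ (d :* (a :- c))))
      refl
      where open +-*-Solver

    neg-difference : ∀ a b → ℚ.- (a ℚ.- b) ≡ b ℚ.- a
    neg-difference = solve 2 (λ a b → (:- (a :- b)) := (b :- a)) refl
      where open +-*-Solver

    neg-difference′ : ∀ a b → ℚ.- (a ℚ.- b) ≡ (ℚ.- a) ℚ.- (ℚ.- b)
    neg-difference′ = solve 2 (λ a b → (:- (a :- b)) := ((:- a) :- (:- b))) refl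
      where open +-*-Solver

    cancel-add : ∀ a b → a ≡ (a ℚ.- b) ℚ.+ b
    cancel-add = solve 2 (λ a b → a := ((a :- b) :+ b)) refl
      where open +-*-Solver

    cancel-sub : ∀ a b → (a ℚ.+ b) ℚ.- b ≡ a
    cancel-sub = solve 2 (λ a b → ((a :+ b) :- b) := a) refl
      where open +-*-Solver

    half-pos : ∀ {ε} → 0ℚ ℚ.< ε → 0ℚ ℚ.< ½ ℚ.* ε
    half-pos {ε} ε>0 = ℚₚ.positive⁻¹ (½ ℚ.* ε)
      where instance
        ε⁺ : ℚ.Positive ε
        ε⁺ = ℚ.positive ε>0
        ½ε⁺ : ℚ.Positive (½ ℚ.* ε)
        ½ε⁺ = ℚₚ.pos*pos⇒pos ½ ε

    half+half : ∀ ε → ½ ℚ.* ε ℚ.+ ½ ℚ.* ε ≡ ε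
    half+half ε = trans (sym (ℚₚ.*-distribʳ-+ ε ½ ½)) (ℚₚ.*-identityˡ ε)

    const-cauchy : ∀ q → IsCauchy (λ _ → q)
    const-cauchy q ε ε>0 = 0 , λ _ _ _ _ →
      subst (λ z → ℚ.∣ z ∣ ℚ.< ε) (sym (ℚₚ.+-inverseʳ q)) ε>0

    +-cauchy : ∀ s t → IsCauchy s → IsCauchy t → IsCauchy (λ n → s n ℚ.+ t n)
    +-cauchy s t cs ct ε ε>0
      with N , p ← cs (½ ℚ.* ε) (half-pos ε>0)
         | M , q ← ct (½ ℚ.* ε) (half-pos ε>0)
      = N ⊔ M , λ m n h k → begin-strict
          ℚ.∣ (s m ℚ.+ t m) ℚ.- (s n ℚ.+ t n) ∣
            ≡⟨ cong ℚ.∣_∣ (sum-difference (s m) (t m) (s n) (t n)) ⟩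
          ℚ.∣ (s m ℚ.- s n) ℚ.+ (t m ℚ.- t n) ∣
            ≤⟨ ℚₚ.∣p+q∣≤∣p∣+∣q∣ (s m ℚ.- s n) (t m ℚ.- t n) ⟩
          ℚ.∣ s m ℚ.- s n ∣ ℚ.+ ℚ.∣ t m ℚ.- t n ∣
            <⟨ ℚₚ.+-mono-<
                 (p m n (ℕₚ.m⊔n≤o⇒m≤o N M h) (ℕₚ.m⊔n≤o⇒m≤o N M k))
                 (q m n (ℕₚ.m⊔n≤o⇒n≤o N M h) (ℕₚ.m⊔n≤o⇒n≤o N M k)) ⟩
          ½ ℚ.* ε ℚ.+ ½ ℚ.* ε ≡⟨ half+half ε ⟩
          ε ∎
      where open ℚₚ.≤-Reasoning

    neg-cauchy : ∀ s → IsCauchy s → IsCauchy (λ n → ℚ.- s n)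
    neg-cauchy s cs ε ε>0 with N , p ← cs ε ε>0
      = N , λ m n h k → subst (ℚ._< ε) (eq (s m) (s n)) (p m n h k)
      where
      eq : ∀ a b → ℚ.∣ a ℚ.- b ∣ ≡ ℚ.∣ (ℚ.- a) ℚ.- (ℚ.- b) ∣
      eq a b = trans (sym (ℚₚ.∣-p∣≡∣p∣ (a ℚ.- b)))
        (cong ℚ.∣_∣ (neg-difference′ a b))

    ∣a∣-∣b∣≤∣a-b∣ : ∀ a b → ℚ.∣ a ∣ ℚ.- ℚ.∣ b ∣ ℚ.≤ ℚ.∣ a ℚ.- b ∣
    ∣a∣-∣b∣≤∣a-b∣ a b = begin
      ℚ.∣ a ∣ ℚ.- ℚ.∣ b ∣
        ≡⟨ cong (λ z → ℚ.∣ z ∣ ℚ.- ℚ.∣ b ∣)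
             (cancel-add a b) ⟩
      ℚ.∣ (a ℚ.- b) ℚ.+ b ∣ ℚ.- ℚ.∣ b ∣
        ≤⟨ ℚₚ.+-monoˡ-≤ (ℚ.- ℚ.∣ b ∣) (ℚₚ.∣p+q∣≤∣p∣+∣q∣ (a ℚ.- b) b) ⟩
      (ℚ.∣ a ℚ.- b ∣ ℚ.+ ℚ.∣ b ∣) ℚ.- ℚ.∣ b ∣
        ≡⟨ cancel-sub ℚ.∣ a ℚ.- b ∣ ℚ.∣ b ∣ ⟩
      ℚ.∣ a ℚ.- b ∣ ∎
      where open ℚₚ.≤-Reasoning

    ∣a-b∣≡∣b-a∣ : ∀ a b → ℚ.∣ a ℚ.- b ∣ ≡ ℚ.∣ b ℚ.- a ∣
    ∣a-b∣≡∣b-a∣ a b = trans (sym (ℚₚ.∣-p∣≡∣p∣ (a ℚ.- b)))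
      (cong ℚ.∣_∣ (neg-difference a b))
      where open +-*-Solver

    reverse-triangle : ∀ a b → ℚ.∣ ℚ.∣ a ∣ ℚ.- ℚ.∣ b ∣ ∣ ℚ.≤ ℚ.∣ a ℚ.- b ∣
    reverse-triangle a b with ℚₚ.∣p∣≡p∨∣p∣≡-p (ℚ.∣ a ∣ ℚ.- ℚ.∣ b ∣)
    ... | inj₁ e = subst (ℚ._≤ ℚ.∣ a ℚ.- b ∣) (sym e) (∣a∣-∣b∣≤∣a-b∣ a b)
    ... | inj₂ e = begin
      ℚ.∣ ℚ.∣ a ∣ ℚ.- ℚ.∣ b ∣ ∣ ≡⟨ e ⟩
      ℚ.- (ℚ.∣ a ∣ ℚ.- ℚ.∣ b ∣)
        ≡⟨ neg-difference ℚ.∣ a ∣ ℚ.∣ b ∣ ⟩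
      ℚ.∣ b ∣ ℚ.- ℚ.∣ a ∣       ≤⟨ ∣a∣-∣b∣≤∣a-b∣ b a ⟩
      ℚ.∣ b ℚ.- a ∣             ≡⟨ ∣a-b∣≡∣b-a∣ b a ⟩
      ℚ.∣ a ℚ.- b ∣             ∎
      where open ℚₚ.≤-Reasoning

    abs-cauchy : ∀ s → IsCauchy s → IsCauchy (λ n → ℚ.∣ s n ∣)
    abs-cauchy s cs ε ε>0 with N , p ← cs ε ε>0
      = N , λ m n h k → ℚₚ.≤-<-trans (reverse-triangle (s m) (s n)) (p m n h k)

    eventually-bounded : ∀ s → IsCauchy s →
      ∃ λ B → 0ℚ ℚ.< B × ∃ λ N → ∀ n → N ℕ.≤ n → ℚ.∣ s n ∣ ℚ.≤ B
    eventually-bounded s cs with N , p ← cs 1ℚ (ℚₚ.positive⁻¹ 1ℚ)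
      = 1ℚ ℚ.+ ℚ.∣ s N ∣
      , ℚₚ.+-mono-<-≤ (ℚₚ.positive⁻¹ 1ℚ) (ℚₚ.0≤∣p∣ (s N))
      , N , λ n h → begin
          ℚ.∣ s n ∣
            ≡⟨ cong ℚ.∣_∣ (cancel-add (s n) (s N)) ⟩
          ℚ.∣ (s n ℚ.- s N) ℚ.+ s N ∣
            ≤⟨ ℚₚ.∣p+q∣≤∣p∣+∣q∣ (s n ℚ.- s N) (s N) ⟩
          ℚ.∣ s n ℚ.- s N ∣ ℚ.+ ℚ.∣ s N ∣
            ≤⟨ ℚₚ.+-monoˡ-≤ ℚ.∣ s N ∣ (ℚₚ.<⇒≤ (p n N h ℕₚ.≤-refl)) ⟩
          1ℚ ℚ.+ ℚ.∣ s N ∣ ∎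
      where open ℚₚ.≤-Reasoning

    shrink : ∀ {B ε} → 0ℚ ℚ.< B → 0ℚ ℚ.< ε →
      ∃ λ δ → 0ℚ ℚ.< δ × (∀ a b → ℚ.∣ a ∣ ℚ.≤ B → ℚ.∣ b ∣ ℚ.< δ →
                            ℚ.∣ a ℚ.* b ∣ ℚ.< ε)
    shrink {B} {ε} B>0 ε>0 = δ , ℚₚ.positive⁻¹ δ , bound
      where
      open ℚₚ.≤-Reasoning
      instance
        B⁺ : ℚ.Positive B
        B⁺ = ℚ.positive B>0
        ε⁺ : ℚ.Positive ε
        ε⁺ = ℚ.positive ε>0
        B≢0 : ℚ.NonZero B
        B≢0 = ℚₚ.pos⇒nonZero B
        B⁻¹⁺ : ℚ.Positive (ℚ.1/ B)
        B⁻¹⁺ = ℚₚ.1/pos⇒pos B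
      δ : ℚ
      δ = ℚ.1/ B ℚ.* ε
      instance
        δ⁺ : ℚ.Positive δ
        δ⁺ = ℚₚ.pos*pos⇒pos (ℚ.1/ B) ε
      bound : ∀ a b → ℚ.∣ a ∣ ℚ.≤ B → ℚ.∣ b ∣ ℚ.< δ → ℚ.∣ a ℚ.* b ∣ ℚ.< ε
      bound a b a≤B b<δ = begin-strict
        ℚ.∣ a ℚ.* b ∣         ≡⟨ ℚₚ.∣p*q∣≡∣p∣*∣q∣ a b ⟩
        ℚ.∣ a ∣ ℚ.* ℚ.∣ b ∣   ≤⟨ ℚₚ.*-monoʳ-≤-nonNeg ℚ.∣ b ∣ {{ℚₚ.∣-∣-nonNeg b}} a≤B ⟩
        B ℚ.* ℚ.∣ b ∣         <⟨ ℚₚ.*-monoʳ-<-pos B b<δ ⟩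
        B ℚ.* (ℚ.1/ B ℚ.* ε)  ≡⟨ sym (ℚₚ.*-assoc B (ℚ.1/ B) ε) ⟩
        (B ℚ.* ℚ.1/ B) ℚ.* ε  ≡⟨ cong (ℚ._* ε) (ℚₚ.*-inverseʳ B) ⟩
        1ℚ ℚ.* ε              ≡⟨ ℚₚ.*-identityˡ ε ⟩
        ε                     ∎

    product-close : ∀ {ε} a b c d →
      ℚ.∣ a ℚ.* (b ℚ.- d) ∣ ℚ.< ½ ℚ.* ε → ℚ.∣ d ℚ.* (a ℚ.- c) ∣ ℚ.< ½ ℚ.* ε →
      ℚ.∣ a ℚ.* b ℚ.- c ℚ.* d ∣ ℚ.< ε
    product-close {ε} a b c d p q =
      subst (ℚ._< ε) (cong ℚ.∣_∣ (sym (product-difference a b c d)))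
        (subst (ℚ.∣ a ℚ.* (b ℚ.- d) ℚ.+ d ℚ.* (a ℚ.- c) ∣ ℚ.<_) (half+half ε)
          (ℚₚ.≤-<-trans (ℚₚ.∣p+q∣≤∣p∣+∣q∣ (a ℚ.* (b ℚ.- d)) (d ℚ.* (a ℚ.- c)))
            (ℚₚ.+-mono-< p q)))

    *-cauchy : ∀ s t → IsCauchy s → IsCauchy t → IsCauchy (λ n → s n ℚ.* t n)
    *-cauchy s t cs ct ε ε>0 =
      let B , B>0 , K , bs = eventually-bounded s cs
          C , C>0 , L , bt = eventually-bounded t ct
          δ , δ>0 , sδ = shrink B>0 (half-pos ε>0)
          γ , γ>0 , tγ = shrink C>0 (half-pos ε>0)
          N , p = cs γ γ>0
          M , q = ct δ δ>0
      in (K ⊔ L) ⊔ (N ⊔ M) , λ m n h k →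
        let h₁ = ℕₚ.m⊔n≤o⇒m≤o (K ⊔ L) (N ⊔ M) h
            h₂ = ℕₚ.m⊔n≤o⇒n≤o (K ⊔ L) (N ⊔ M) h
            k₁ = ℕₚ.m⊔n≤o⇒m≤o (K ⊔ L) (N ⊔ M) k
            k₂ = ℕₚ.m⊔n≤o⇒n≤o (K ⊔ L) (N ⊔ M) k
        in product-close (s m) (t m) (s n) (t n)
             (sδ (s m) (t m ℚ.- t n) (bs m (ℕₚ.m⊔n≤o⇒m≤o K L h₁))
               (q m n (ℕₚ.m⊔n≤o⇒n≤o N M h₂) (ℕₚ.m⊔n≤o⇒n≤o N M k₂)))
             (tγ (t n) (s m ℚ.- s n) (bt n (ℕₚ.m⊔n≤o⇒n≤o K L k₁))
               (p m n (ℕₚ.m⊔n≤o⇒m≤o N M h₂) (ℕₚ.m⊔n≤o⇒m≤o N M k₂)))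

infixl 6 _+ℝ_
infixl 7 _*ℝ_
infix  8 -ℝ_

fromℚ : ℚ → ℝ
fromℚ q = mkℝ (λ _ → q) (const-cauchy q)

_+ℝ_ : ℝ → ℝ → ℝ
x +ℝ y = mkℝ (λ n → seq x n ℚ.+ seq y n) (+-cauchy (seq x) (seq y) (cauchy x) (cauchy y))

_*ℝ_ : ℝ → ℝ → ℝ
x *ℝ y = mkℝ (λ n → seq x n ℚ.* seq y n) (*-cauchy (seq x) (seq y) (cauchy x) (cauchy y))

-ℝ_ : ℝ → ℝ
-ℝ x = mkℝ (λ n → ℚ.- seq x n) (neg-cauchy (seq x) (cauchy x))

absℝ : ℝ → ℝ
absℝ x = mkℝ (λ n → ℚ.∣ seq x n ∣) (abs-cauchy (seq x) (cauchy x))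

0ℝ 1ℝ : ℝ
0ℝ = fromℚ 0ℚ
1ℝ = fromℚ 1ℚ

fromℕ : ℕ → ℝ
fromℕ n = fromℚ (+ n ℚ./ 1)

ℝ-rawRing : RawRing 0ℓ 0ℓ
ℝ-rawRing = record
  { Carrier = ℝ
  ; _≈_     = _≃_
  ; _+_     = _+ℝ_
  ; _*_     = _*ℝ_
  ; -_      = -ℝ_
  ; 0#      = 0ℝ
  ; 1#      = 1ℝ
  }

------------------------------------------------------------------------
-- Square matrices over a ring

module Matrices {c ℓ} (R : RawRing c ℓ) where
  open RawRing R

  open RawMonoidDefs +-rawMonoid public using (sum)
  open RawMonoidDefs *-rawMonoid public using () renaming (sum to product)

  Matrix : ℕ → Set c
  Matrix n = Fin n → Fin n → Carrier

  sign : ∀ {n} → Fin n → Carrier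
  sign Fin.zero    = 1#
  sign (Fin.suc j) = - sign j

  minor : ∀ {n} → Matrix (ℕ.suc n) → Fin (ℕ.suc n) → Matrix n
  minor M j i k = M (Fin.suc i) (punchIn j k)

  -- Laplace expansion along the first row.
  det : ∀ {n} → Matrix n → Carrier
  det {ℕ.zero}  M = 1#
  det {ℕ.suc n} M = sum (λ j → sign j * M Fin.zero j * det (minor M j))

  scalar : ∀ {n} → Carrier → Matrix n
  scalar x i j = if does (i ≟ᶠ j) then x else 0#

  charPoly : ∀ {n} → Matrix n → Carrier → Carrier
  charPoly M x = det (λ i j → scalar x i j + - M i j)

  -- μ lists the eigenvalues of M with their algebraic multiplicities:
  -- det (x I − M) = ∏ᵢ (x − μᵢ) for all x.  This presupposes that the
  -- characteristic polynomial splits over R (over ℝ it does for symmetric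
  -- M) and that polynomials are determined by their values (true over ℝ).
  IsSpectrum : ∀ {n} → Matrix n → Vector Carrier n → Set _
  IsSpectrum M μ = ∀ x → charPoly M x ≈ product (λ i → x + - μ i)

------------------------------------------------------------------------
-- Graphs

record Graph (n : ℕ) : Set where
  field
    adj    : Fin n → Fin n → Bool
    symm   : ∀ i j → adj i j ≡ adj j i
    irrefl : ∀ i → adj i i ≡ false

module _ {n : ℕ} (G : Graph n) where
  open Graph G
  open Matrices ℝ-rawRing using (Matrix; IsSpectrum) renaming (sum to sumℝ)
  open RawMonoidDefs ℕ.+-0-rawMonoid using () renaming (sum to sumℕ)

  neighbours : Fin n → Subset n
  neighbours i = tabulate (adj i)

  degree : Fin n → ℕ
  degree i = ∣ neighbours i ∣

  maxDegree : ℕ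
  maxDegree = Vector.foldr _⊔_ 0 degree

  -- Each edge {i , j} is counted once, at its smaller endpoint.
  edgeCount : ℕ
  edgeCount = sumℕ λ i → ∣ tabulate (λ j → (toℕ i <ᵇ toℕ j) ∧ adj i j) ∣

  adjacencyMatrix : Matrix n
  adjacencyMatrix i j = if adj i j then 1ℝ else 0ℝ

  -- Stated as a relation, since a list of eigenvalues is determined only up
  -- to order and _≃_; their absolute sum is unique up to _≃_.
  IsEnergy : ℝ → Set
  IsEnergy E = ∃ λ (μ : Vector ℝ n) →
    IsSpectrum adjacencyMatrix μ × E ≃ sumℝ (λ i → absℝ (μ i))

module Submission where

-- An adjacency matrix A and the diagonal matrix of its spectrum have the same
-- characteristic polynomial P.  Put Q_m(x) = tr (A^m adj (x I − A)).  Then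
-- Q_0 = P′ by Jacobi's formula, x Q_m = Q_{m+1} + P tr A^m, and deg Q_m < deg P;
-- as P is monic, all tr A^m are determined by P, so tr A^m = ∑ μᵢ^m.
--
-- Counting closed walks, with degrees at most 4 and degree sum 4n − 2:
-- ∑ μᵢ² = 4n − 2; ∑ μᵢ⁴ ≥ 2 ∑ dᵢ² − ∑ dᵢ ≥ 28n − 26, as (dᵢ − 3)(dᵢ − 4) ≥ 0;
-- and ∑ μᵢ⁶⁴ ≤ 4⁶⁴ n, whence |μᵢ| ≤ 21/5.  On [0 , 21/5] one has
-- 99127 t ≤ 79233 + 33222 t² − 800 t⁴, and summing over t = |μᵢ| bounds the
-- energy below 2n − 2 as soon as n ≥ 18 (up to n = 21, for the bound 21/5).

open import Defs
open import Algebra.Bundles using (CommutativeRing)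
open import Algebra.Bundles.Raw using (RawRing)
import Algebra.Definitions.RawMonoid as RawMonoidDefs
import Algebra.Definitions.RawSemiring as RawSemiringDefs
import Algebra.Properties.Ring
import Algebra.Properties.Semiring.Exp
import Algebra.Properties.Semiring.Sum
open import Data.Bool.Base using (Bool; true; false; _∧_; if_then_else_)
open import Data.Bool.Properties using (T-≡; ¬-not)
open import Data.Fin.Base using (Fin; zero; suc; punchIn; toℕ)
open import Data.Fin.Properties using (suc-injective; toℕ-injective) renaming (_≟_ to _≟ᶠ_)
import Data.Fin.Subset as Subset
open import Data.Integer.Base as ℤ using ()
import Data.Integer.Properties as ℤₚ
open import Data.Nat.Base as ℕ using (ℕ; zero; suc)
import Data.Nat.Properties as ℕₚ
open import Data.Nat.Solver renaming (module +-*-Solver to ℕ-Solver)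
open import Data.Product.Base using (∃; ∃₂; _×_; _,_; proj₁; proj₂)
open import Data.Rational.Base as ℚ using (ℚ; 0ℚ; 1ℚ; ½)
import Data.Rational.Properties as ℚₚ
open import Data.Rational.Solver renaming (module +-*-Solver to ℚ-Solver)
import Data.Rational.Unnormalised.Base as ℚᵘ
import Data.Rational.Unnormalised.Properties as ℚᵘₚ
open import Data.Sum.Base using (_⊎_; inj₁; inj₂)
open import Data.Vec.Base using (tabulate)
import Data.Vec.Functional as Vector
open import Data.Vec.Functional using (Vector; updateAt; _∷_)
open import Data.Vec.Functional.Properties using (updateAt-updates; updateAt-minimal; updateAt-id-local)
open import Function.Base using (_∘_; const)
open import Function.Bundles using (Equivalence)
open import Level using (0ℓ; _⊔_)
open import Relation.Binary.Definitions using (tri<; tri≈; tri>)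
open import Relation.Binary.PropositionalEquality as ≡ using (_≡_; _≢_)
open import Relation.Nullary.Decidable using (Dec; does; yes; no; from-yes)
open import Relation.Nullary.Negation using (contradiction)

-- Over these reals neither equality nor order can be decided, and the spectrum is known only
-- through the values of a polynomial: there are no eigenvectors to work with. The algebra is
-- therefore done over any commutative ring in which positive naturals are units. A polynomial
-- function that vanishes at p, p + 1, p + 2, ... vanishes identically, leading coefficient
-- included, because these points differ by units; this replaces cancellation in a field.
--
-- The inequalities are proved at a fixed late index k, for the k-th rational approximants of the μᵢ
-- and of the energy. In ℚ signs can be decided, and each passage from an equality in ℝ to the index
-- k costs a tolerance. A single power sum cannot give |μᵢ| ≤ 4, as its n terms leave a factor of
-- the 64th root of n; 21/5 is what survives, and the room between n ≥ 18 and n ≥ 20 pays for the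
-- tolerances.

-- Polynomial functions over a commutative ring

module PolynomialFunctions {c ℓ} (R : CommutativeRing c ℓ) where

  open CommutativeRing R hiding (zero)
  open Matrices rawRing
  open Algebra.Properties.Ring ring using (-‿distribˡ-*; -‿distribʳ-*)
  open Algebra.Properties.Semiring.Sum semiring
    using (sum-cong-≋; sum-replicate-zero; ∑-distrib-+; *-distribˡ-sum)
  open import Relation.Binary.Reasoning.Setoid setoid

  open import Algebra.Solver.Ring.NaturalCoefficients.Default commutativeSemiring
    using (solve; _:+_; _:*_; _:=_)

  -- Explicit summands: sum unfolds on a successor length, which blocks inference.
  sum-ext : ∀ {n} (f g : Fin n → Carrier) → (∀ i → f i ≈ g i) → sum f ≈ sum g
  sum-ext f g h = sum-cong-≋ h

  sum-zero : ∀ {n} (f : Fin n → Carrier) → (∀ i → f i ≈ 0#) → sum f ≈ 0#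
  sum-zero {n} f h = trans (sum-cong-≋ h) (sum-replicate-zero n)

  sum-linear : ∀ {n} (f g : Fin n → Carrier) a →
    sum (λ i → f i + a * g i) ≈ sum f + a * sum g
  sum-linear f g a =
    trans (∑-distrib-+ f (λ i → a * g i)) (+-congˡ (sym (*-distribˡ-sum a g)))

  -- f is a polynomial function of degree at most d with coefficient a in
  -- degree d (a may vanish), in Horner form.
  Deg : ℕ → Carrier → (Carrier → Carrier) → Set (c ⊔ ℓ)
  Deg zero    a f = ∀ x → f x ≈ a
  Deg (suc d) a f = ∃₂ λ b g → Deg d a g × (∀ x → f x ≈ b + x * g x)

  deg-cong : ∀ d {a b f g} → a ≈ b → (∀ x → f x ≈ g x) → Deg d a f → Deg d b g
  deg-cong zero    a≈b f≈g h x = trans (sym (f≈g x)) (trans (h x) a≈b)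
  deg-cong (suc d) a≈b f≈g (b , g , k , h) =
    b , g , deg-cong d a≈b (λ _ → refl) k , λ x → trans (sym (f≈g x)) (h x)

  -- Allowing the leading coefficient to vanish lets degrees be padded; polynomials of different
  -- degrees are added after padding.
  deg-raise : ∀ d {a f} → Deg d a f → Deg (suc d) 0# f
  deg-raise zero {a} h =
    a , (λ _ → 0#) , (λ _ → refl) , λ x → trans (h x) (eq a x)
    where
    eq : ∀ a x → a ≈ a + x * 0#
    eq a x = sym (trans (+-congˡ (zeroʳ x)) (+-identityʳ a))
  deg-raise (suc d) (b , g , k , h) = b , g , deg-raise d k , h

  deg-raise⁺ : ∀ k {d a f} → Deg d a f → Deg (suc (k ℕ.+ d)) 0# f
  deg-raise⁺ zero    {d} h = deg-raise d h
  deg-raise⁺ (suc k) {d} h = deg-raise (suc (k ℕ.+ d)) (deg-raise⁺ k h)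

  deg-+ : ∀ d {a b f g} → Deg d a f → Deg d b g → Deg d (a + b) (λ x → f x + g x)
  deg-+ zero    h k x = +-cong (h x) (k x)
  deg-+ (suc d) (b , g , u , h) (b′ , g′ , u′ , h′) =
    b + b′ , (λ x → g x + g′ x) , deg-+ d u u′ ,
    λ x → trans (+-cong (h x) (h′ x)) (eq b x (g x) b′ (g′ x))
    where
    eq : ∀ b x g b′ g′ → (b + x * g) + (b′ + x * g′) ≈ (b + b′) + x * (g + g′)
    eq = solve 5 (λ b x g b′ g′ → (b :+ x :* g) :+ (b′ :+ x :* g′) := (b :+ b′) :+ x :* (g :+ g′)) refl

  deg-scale : ∀ d k {a f} → Deg d a f → Deg d (k * a) (λ x → k * f x)
  deg-scale zero    k h x = *-congˡ (h x)
  deg-scale (suc d) k (b , g , u , h) =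
    k * b , (λ x → k * g x) , deg-scale d k u ,
    λ x → trans (*-congˡ (h x)) (eq k b x (g x))
    where
    eq : ∀ k b x g → k * (b + x * g) ≈ k * b + x * (k * g)
    eq = solve 4 (λ k b x g → k :* (b :+ x :* g) := k :* b :+ x :* (k :* g)) refl

  deg-* : ∀ d e {a b f g} → Deg d a f → Deg e b g → Deg (d ℕ.+ e) (a * b) (λ x → f x * g x)
  deg-* zero    e {a} h k =
    deg-cong e refl (λ x → *-congʳ (sym (h x))) (deg-scale e a k)
  deg-* (suc d) e {a} {b} {f} {g} (b₀ , f₁ , u , h) k =
    deg-cong (suc (d ℕ.+ e)) (+-identityˡ _)
      (λ x → trans (eq b₀ x (f₁ x) (g x)) (*-congʳ (sym (h x))))
      (deg-+ (suc (d ℕ.+ e)) (deg-raise⁺ d (deg-scale e b₀ k))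
        (0# , (λ x → f₁ x * g x) , deg-* d e u k , λ x → sym (+-identityˡ _)))
    where
    eq : ∀ b x f g → b * g + x * (f * g) ≈ (b + x * f) * g
    eq = solve 4 (λ b x f g → b :* g :+ x :* (f :* g) := (b :+ x :* f) :* g) refl

  deg-sum : ∀ d {n} {a : Fin n → Carrier} {f : Fin n → Carrier → Carrier} →
    (∀ j → Deg d (a j) (f j)) → Deg d (sum a) (λ x → sum (λ j → f j x))
  deg-sum zero    {n} h x = sum-cong-≋ (λ j → h j x)
  deg-sum (suc d) {n} {a} {f} h =
    sum (λ j → proj₁ (h j)) , (λ x → sum (λ j → proj₁ (proj₂ (h j)) x)) ,
    deg-sum d (λ j → proj₁ (proj₂ (proj₂ (h j)))) ,
    λ x → trans (sum-cong-≋ (λ j → proj₂ (proj₂ (proj₂ (h j))) x))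
      (sum-linear (λ j → proj₁ (h j)) (λ j → proj₁ (proj₂ (h j)) x) x)

  x-p+p : ∀ x p → x ≈ (x - p) + p
  x-p+p x p = sym (trans (+-assoc x (- p) p)
    (trans (+-congˡ (-‿inverseˡ p)) (+-identityʳ x)))

  -- Synthetic division: if g = g(p) + (x - p) q, then b + x g has the quotient g + p q. The
  -- quotient keeps the leading coefficient `a`, which `deg-vanish` needs in order to conclude that
  -- `a` is zero.
  factor : ∀ d {a f} → Deg (suc d) a f → ∀ p →
    ∃ λ g → Deg d a g × (∀ x → f x ≈ f p + (x - p) * g x)
  factor zero {a} {f} (b , g , k , h) p = g , k , λ x → begin
    f x                             ≈⟨ h x ⟩
    b + x * g x                     ≈⟨ +-congˡ (*-congʳ (x-p+p x p)) ⟩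
    b + ((x - p) + p) * g x         ≈⟨ eq b (x - p) p (g x) ⟩
    (b + p * g x) + (x - p) * g x
      ≈⟨ +-congʳ (+-congˡ (*-congˡ (trans (k x) (sym (k p))))) ⟩
    (b + p * g p) + (x - p) * g x   ≈⟨ +-congʳ (sym (h p)) ⟩
    f p + (x - p) * g x             ∎
    where
    eq : ∀ b t p g → b + (t + p) * g ≈ (b + p * g) + t * g
    eq = solve 4 (λ b t p g → b :+ (t :+ p) :* g := (b :+ p :* g) :+ t :* g) refl
  factor (suc d) {a} {f} (b , g , k , h) p with factor d k p
  ... | q , l , m =
    (λ x → g x + p * q x) ,
    deg-cong (suc d) (+-identityʳ a) (λ _ → refl)
      (deg-+ (suc d) k (deg-raise d (deg-scale d p l))) ,
    λ x → begin
      f x                             ≈⟨ h x ⟩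
      b + x * g x                     ≈⟨ +-congˡ (*-congʳ (x-p+p x p)) ⟩
      b + ((x - p) + p) * g x         ≈⟨ eq₁ b (x - p) p (g x) ⟩
      b + (x - p) * g x + p * g x     ≈⟨ +-congˡ (*-congˡ (m x)) ⟩
      b + (x - p) * g x + p * (g p + (x - p) * q x)
        ≈⟨ eq₂ b (x - p) p (g x) (g p) (q x) ⟩
      (b + p * g p) + (x - p) * (g x + p * q x) ≈⟨ +-congʳ (sym (h p)) ⟩
      f p + (x - p) * (g x + p * q x) ∎
    where
    eq₁ : ∀ b t p g → b + (t + p) * g ≈ b + t * g + p * g
    eq₁ = solve 4 (λ b t p g → b :+ (t :+ p) :* g := b :+ t :* g :+ p :* g) refl
    eq₂ : ∀ b t p g g′ q → b + t * g + p * (g′ + t * q) ≈ (b + p * g′) + t * (g + p * q)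
    eq₂ = solve 6 (λ b t p g g′ q → b :+ t :* g :+ p :* (g′ :+ t :* q) := (b :+ p :* g′) :+ t :* (g :+ p :* q)) refl

  nat : ℕ → Carrier
  nat zero    = 0#
  nat (suc n) = 1# + nat n

  nat-+ : ∀ m n → nat (m ℕ.+ n) ≈ nat m + nat n
  nat-+ zero    n = sym (+-identityˡ _)
  nat-+ (suc m) n = trans (+-congˡ (nat-+ m n)) (sym (+-assoc _ _ _))

  -- Characteristic zero in the form of units: a factor `nat (suc j)` is cancelled by
  -- multiplication, without a case distinction on zero.
  NatsInvertible : Set (c ⊔ ℓ)
  NatsInvertible = ∀ n → ∃ λ u → u * nat (suc n) ≈ 1#

  module _ (inv : NatsInvertible) where

    nat-cancel : ∀ n {x} → nat (suc n) * x ≈ 0# → x ≈ 0#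
    nat-cancel n {x} h = let u , e = inv n in begin
      x                     ≈⟨ sym (*-identityˡ x) ⟩
      1# * x                ≈⟨ *-congʳ (sym e) ⟩
      u * nat (suc n) * x   ≈⟨ *-assoc _ _ _ ⟩
      u * (nat (suc n) * x) ≈⟨ *-congˡ h ⟩
      u * 0#                ≈⟨ zeroʳ u ⟩
      0#                    ∎

    -- Each division removes the root p + k. At the later points p + k + j + 1 the factor x - (p +
    -- k) is the unit `nat (suc j)`, so the quotient vanishes there; the induction advances `k`.
    deg-vanish : ∀ d {a f} → Deg d a f → ∀ p k →
      (∀ j → f (p + nat (j ℕ.+ k)) ≈ 0#) → a ≈ 0# × (∀ x → f x ≈ 0#)
    deg-vanish zero    h p k v =
      let a≈0 = trans (sym (h _)) (v 0) in a≈0 , λ x → trans (h x) a≈0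
    deg-vanish (suc d) {a} {f} h p k v =
      let g , u , e = factor d h (p + nat k)
          f≈ : ∀ x → f x ≈ (x - (p + nat k)) * g x
          f≈ x = trans (e x) (trans (+-congʳ (v 0)) (+-identityˡ _))
          w : ∀ j → g (p + nat (suc j ℕ.+ k)) ≈ 0#
          w j = nat-cancel j (trans (*-congʳ (sym (gap j)))
            (trans (sym (f≈ (p + nat (suc j ℕ.+ k)))) (v (suc j))))
          w′ : ∀ j → g (p + nat (j ℕ.+ suc k)) ≈ 0#
          w′ j = ≡.subst (λ z → g (p + nat z) ≈ 0#) (≡.sym (ℕₚ.+-suc j k)) (w j)
          a≈0 , g≈0 = deg-vanish d u p (suc k) w′
      in a≈0 , λ x → trans (f≈ x) (trans (*-congˡ (g≈0 x)) (zeroʳ _))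
      where
      gap : ∀ j → (p + nat (suc j ℕ.+ k)) - (p + nat k) ≈ nat (suc j)
      gap j = begin
        (p + nat (suc j ℕ.+ k)) - (p + nat k)
          ≈⟨ +-congʳ (+-congˡ (nat-+ (suc j) k)) ⟩
        (p + (nat (suc j) + nat k)) - (p + nat k)
          ≈⟨ +-congʳ (eq p (nat (suc j)) (nat k)) ⟩
        (nat (suc j) + (p + nat k)) - (p + nat k)
          ≈⟨ +-assoc _ _ _ ⟩
        nat (suc j) + ((p + nat k) - (p + nat k))
          ≈⟨ trans (+-congˡ (-‿inverseʳ _)) (+-identityʳ _) ⟩
        nat (suc j) ∎
        where
        eq : ∀ p a b → p + (a + b) ≈ a + (p + b)
        eq = solve 3 (λ p a b → p :+ (a :+ b) := a :+ (p :+ b)) refl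

  -- Algebraic derivatives of polynomial functions

  Poly : (Carrier → Carrier) → Set (c ⊔ ℓ)
  Poly f = ∃ λ d → Deg d 0# f

  deg⇒poly : ∀ d {a f} → Deg d a f → Poly f
  deg⇒poly d h = suc d , deg-raise d h

  poly-const : ∀ a → Poly (λ _ → a)
  poly-const a = deg⇒poly 0 (λ _ → refl)

  poly-cong : ∀ {f g} → (∀ x → f x ≈ g x) → Poly f → Poly g
  poly-cong e (d , h) = d , deg-cong d refl e h

  poly-+ : ∀ {f g} → Poly f → Poly g → Poly (λ x → f x + g x)
  poly-+ {f} {g} (d , h) (e , k) = suc (e ℕ.+ d) ,
    deg-cong (suc (e ℕ.+ d)) (+-identityˡ 0#) (λ _ → refl)
      (deg-+ (suc (e ℕ.+ d)) (deg-raise⁺ e h)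
        (≡.subst (λ z → Deg (suc z) 0# g) (ℕₚ.+-comm d e) (deg-raise⁺ d k)))

  poly-* : ∀ {f g} → Poly f → Poly g → Poly (λ x → f x * g x)
  poly-* (d , h) (e , k) = d ℕ.+ e ,
    deg-cong (d ℕ.+ e) (zeroˡ 0#) (λ _ → refl) (deg-* d e h k)

  deg-shift : ∀ p → Deg 1 1# (λ x → x - p)
  deg-shift p = - p , (λ _ → 1#) , (λ _ → refl) ,
    λ x → trans (+-comm x (- p)) (+-congˡ (sym (*-identityʳ x)))

  -- Carathéodory's form of b = f′(p): the difference quotient extends to g with g(p) = b. No limit
  -- is involved, and `Poly g` is what makes b unique.
  Deriv : Carrier → (Carrier → Carrier) → Carrier → Set (c ⊔ ℓ)
  Deriv p f b = ∃ λ g → Poly g × (∀ x → f x ≈ f p + (x - p) * g x) × g p ≈ b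

  -- The two difference quotients agree after multiplication by x - p, hence at p + 1, p + 2, ...,
  -- where x - p is a unit; being polynomials, they then agree at p too.
  deriv-unique : NatsInvertible → ∀ {p f f′ b b′} → (∀ x → f x ≈ f′ x) →
    Deriv p f b → Deriv p f′ b′ → b ≈ b′
  deriv-unique inv {p} {f} {f′} {b} {b′} e (g , (_ , u) , h , k) (g′ , u′ , h′ , k′) = begin
    b                  ≈⟨ sym k ⟩
    g p                ≈⟨ x-p+p (g p) (g′ p) ⟩
    (g p - g′ p) + g′ p ≈⟨ +-cong (proj₂ (deg-vanish inv _ (proj₂ diff) p 1 v) p) k′ ⟩
    0# + b′            ≈⟨ +-identityˡ b′ ⟩
    b′                 ∎
    where
    diff : Poly (λ x → g x - g′ x)
    diff = poly-+ (_ , u)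
      (poly-cong (λ x → trans (sym (-‿distribˡ-* 1# (g′ x))) (-‿cong (*-identityˡ _)))
        (poly-* (poly-const (- 1#)) u′))
    same : ∀ x → (x - p) * g x ≈ (x - p) * g′ x
    same x = begin
      (x - p) * g x                  ≈⟨ cancel (f p) _ ⟩
      (f p + (x - p) * g x) - f p    ≈⟨ +-cong (trans (sym (h x)) (trans (e x) (h′ x))) (-‿cong (e p)) ⟩
      (f′ p + (x - p) * g′ x) - f′ p ≈⟨ sym (cancel (f′ p) _) ⟩
      (x - p) * g′ x                 ∎
      where
      cancel : ∀ y z → z ≈ (y + z) - y
      cancel y z = begin
        z             ≈⟨ sym (+-identityʳ z) ⟩
        z + 0#        ≈⟨ +-congˡ (sym (-‿inverseʳ y)) ⟩
        z + (y - y)   ≈⟨ sym (+-assoc z y (- y)) ⟩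
        (z + y) - y   ≈⟨ +-congʳ (+-comm z y) ⟩
        (y + z) - y   ∎
    gap : ∀ j → (p + nat (j ℕ.+ 1)) - p ≈ nat (suc j)
    gap j = begin
      (p + nat (j ℕ.+ 1)) - p   ≡⟨ ≡.cong (λ z → (p + nat z) - p) (ℕₚ.+-comm j 1) ⟩
      (p + nat (suc j)) - p     ≈⟨ +-congʳ (+-comm _ _) ⟩
      (nat (suc j) + p) - p     ≈⟨ +-assoc _ _ _ ⟩
      nat (suc j) + (p - p)     ≈⟨ trans (+-congˡ (-‿inverseʳ p)) (+-identityʳ _) ⟩
      nat (suc j)               ∎
    v : ∀ j → g (p + nat (j ℕ.+ 1)) - g′ (p + nat (j ℕ.+ 1)) ≈ 0#
    v j = let x = p + nat (j ℕ.+ 1) in nat-cancel inv j (begin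
      nat (suc j) * (g x - g′ x)               ≈⟨ distribˡ _ _ _ ⟩
      nat (suc j) * g x + nat (suc j) * - g′ x ≈⟨ +-cong (*-congʳ (sym (gap j)))
                                                   (trans (sym (-‿distribʳ-* _ _)) (-‿cong (*-congʳ (sym (gap j))))) ⟩
      (x - p) * g x - (x - p) * g′ x           ≈⟨ +-congʳ (same x) ⟩
      (x - p) * g′ x - (x - p) * g′ x          ≈⟨ -‿inverseʳ _ ⟩
      0#                                       ∎)

  deriv-poly : ∀ {p f b} → Deriv p f b → Poly f
  deriv-poly {p} {f} (g , u , h , _) =
    poly-cong (λ x → sym (h x))
      (poly-+ (poly-const (f p)) (poly-* (deg⇒poly 1 (deg-shift p)) u))

  deriv-cong : ∀ {p f b b′} → b ≈ b′ → Deriv p f b → Deriv p f b′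
  deriv-cong e (g , u , h , k) = g , u , h , trans k e

  deriv-const : ∀ {p} a → Deriv p (λ _ → a) 0#
  deriv-const a = (λ _ → 0#) , poly-const 0# ,
    (λ x → sym (trans (+-congˡ (zeroʳ _)) (+-identityʳ a))) , refl

  deriv-+ : ∀ {p f g b b′} → Deriv p f b → Deriv p g b′ → Deriv p (λ x → f x + g x) (b + b′)
  deriv-+ {p} {f} {g} (f₁ , u , h , k) (g₁ , u′ , h′ , k′) =
    (λ x → f₁ x + g₁ x) , poly-+ u u′ ,
    (λ x → trans (+-cong (h x) (h′ x)) (eq (f p) (x - p) (f₁ x) (g p) (g₁ x))) ,
    +-cong k k′
    where
    eq : ∀ a t b c d → (a + t * b) + (c + t * d) ≈ (a + c) + t * (b + d)
    eq = solve 5 (λ a t b c d → (a :+ t :* b) :+ (c :+ t :* d) := (a :+ c) :+ t :* (b :+ d)) refl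

  deriv-* : ∀ {p f g b b′} → Deriv p f b → Deriv p g b′ →
    Deriv p (λ x → f x * g x) (b * g p + f p * b′)
  deriv-* {p} {f} {g} df@(f₁ , u , h , k) dg@(g₁ , u′ , h′ , k′) =
    (λ x → f₁ x * g x + f p * g₁ x) ,
    poly-+ (poly-* u (deriv-poly dg)) (poly-* (poly-const (f p)) u′) ,
    (λ x → begin
      f x * g x                                    ≈⟨ *-congʳ (h x) ⟩
      (f p + (x - p) * f₁ x) * g x                 ≈⟨ eq₁ (f p) (x - p) (f₁ x) (g x) ⟩
      f p * g x + (x - p) * (f₁ x * g x)           ≈⟨ +-congʳ (*-congˡ (h′ x)) ⟩
      f p * (g p + (x - p) * g₁ x) + (x - p) * (f₁ x * g x)
        ≈⟨ eq₂ (f p) (x - p) (f₁ x * g x) (g p) (g₁ x) ⟩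
      f p * g p + (x - p) * (f₁ x * g x + f p * g₁ x) ∎) ,
    +-cong (*-congʳ k) (*-congˡ k′)
    where
    eq₁ : ∀ a t b c → (a + t * b) * c ≈ a * c + t * (b * c)
    eq₁ = solve 4 (λ a t b c → (a :+ t :* b) :* c := a :* c :+ t :* (b :* c)) refl
    eq₂ : ∀ a t e c d → a * (c + t * d) + t * e ≈ a * c + t * (e + a * d)
    eq₂ = solve 5 (λ a t e c d → a :* (c :+ t :* d) :+ t :* e := a :* c :+ t :* (e :+ a :* d)) refl

  deriv-sum : ∀ {p n} {f : Fin n → Carrier → Carrier} {b : Fin n → Carrier} →
    (∀ j → Deriv p (f j) (b j)) → Deriv p (λ x → sum (λ j → f j x)) (sum b)
  deriv-sum {n = zero}  h = deriv-const 0#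
  deriv-sum {n = suc n} h = deriv-+ (h zero) (deriv-sum (h ∘ suc))

-- The determinant as an alternating multilinear function of the rows

module Determinants {c ℓ} (R : CommutativeRing c ℓ) where

  open CommutativeRing R hiding (zero)
  open Matrices rawRing
  open PolynomialFunctions R
  open Algebra.Properties.Ring ring using (-‿distribˡ-*; -‿distribʳ-*)
  open Algebra.Properties.Semiring.Sum semiring
    using (∑-distrib-+; *-distribˡ-sum)
  open import Algebra.Solver.Ring.NaturalCoefficients.Default commutativeSemiring
    using (solve; _:+_; _:*_; _:=_)
  open import Relation.Binary.Reasoning.Setoid setoid

  laplace : ∀ {n} → Matrix (suc n) → Fin (suc n) → Carrier
  laplace M j = sign j * M zero j * det (minor M j)

  det-cong : ∀ {n} {M N : Matrix n} → (∀ i j → M i j ≈ N i j) → det M ≈ det N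
  det-cong {zero}  h = refl
  det-cong {suc n} {M} {N} h = sum-ext (laplace M) (laplace N) λ j →
    *-cong (*-congˡ {sign j} (h zero j)) (det-cong (λ i k → h (suc i) (punchIn j k)))

  -- The three matrices are related row by row, not by updates of one matrix, so that the hypotheses
  -- restrict to minors and the induction on the row goes through.
  det-linear : ∀ {n} (p : Fin n) {a} {L M N : Matrix n} →
    (∀ j → L p j ≈ M p j + a * N p j) →
    (∀ i → i ≢ p → ∀ j → L i j ≈ M i j) →
    (∀ i → i ≢ p → ∀ j → L i j ≈ N i j) →
    det L ≈ det M + a * det N
  det-linear zero {a} {L} {M} {N} hp hM hN = trans
    (sum-ext (laplace L) (λ j → laplace M j + a * laplace N j) λ j → begin
      sign j * L zero j * det (minor L j)
        ≈⟨ *-congʳ (*-congˡ (hp j)) ⟩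
      sign j * (M zero j + a * N zero j) * det (minor L j)
        ≈⟨ eq (sign j) (M zero j) a (N zero j) (det (minor L j)) ⟩
      sign j * M zero j * det (minor L j) + a * (sign j * N zero j * det (minor L j))
        ≈⟨ +-cong (*-congˡ (det-cong λ i k → hM (suc i) (λ ()) (punchIn j k)))
             (*-congˡ (*-congˡ (det-cong λ i k → hN (suc i) (λ ()) (punchIn j k)))) ⟩
      sign j * M zero j * det (minor M j) + a * (sign j * N zero j * det (minor N j)) ∎)
    (sum-linear (laplace M) (laplace N) a)
    where
    eq : ∀ s m a n D → s * (m + a * n) * D ≈ s * m * D + a * (s * n * D)
    eq = solve 5 (λ s m a n D → s :* (m :+ a :* n) :* D := s :* m :* D :+ a :* (s :* n :* D)) refl
  det-linear (suc p) {a} {L} {M} {N} hp hM hN = trans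
    (sum-ext (laplace L) (λ j → laplace M j + a * laplace N j) λ j → begin
      sign j * L zero j * det (minor L j)
        ≈⟨ *-cong (*-congˡ (hM zero (λ ()) j)) (det-linear p
             (λ k → hp (punchIn j k))
             (λ i i≢p k → hM (suc i) (i≢p ∘ suc-injective) (punchIn j k))
             (λ i i≢p k → hN (suc i) (i≢p ∘ suc-injective) (punchIn j k))) ⟩
      sign j * M zero j * (det (minor M j) + a * det (minor N j))
        ≈⟨ eq (sign j * M zero j) (det (minor M j)) a (det (minor N j)) ⟩
      sign j * M zero j * det (minor M j) + a * (sign j * M zero j * det (minor N j))
        ≈⟨ +-congˡ (*-congˡ (*-congʳ (*-congˡ
             (trans (sym (hM zero (λ ()) j)) (hN zero (λ ()) j))))) ⟩
      sign j * M zero j * det (minor M j) + a * (sign j * N zero j * det (minor N j)) ∎)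
    (sum-linear (laplace M) (laplace N) a)
    where
    eq : ∀ s D a E → s * (D + a * E) ≈ s * D + a * (s * E)
    eq = solve 4 (λ s D a E → s :* (D :+ a :* E) := s :* D :+ a :* (s :* E)) refl

  private
    -- Column injections that keep the first column: removing two later columns leaves it in place.
    lift : ∀ {m n} → (Fin m → Fin n) → Fin (suc m) → Fin (suc n)
    lift f zero    = zero
    lift f (suc r) = suc (f r)

    lift-cong : ∀ {m n} {f g : Fin m → Fin n} → (∀ r → f r ≡ g r) → ∀ r → lift f r ≡ lift g r
    lift-cong h zero    = ≡.refl
    lift-cong h (suc r) = ≡.cong suc (h r)

  -- The terms of the double Laplace expansion for the column pairs
  -- (j , k) and (k , j) have opposite signs.
  laplace²-symmetric : ∀ {n} (T : Fin (2 ℕ.+ n) → Fin (2 ℕ.+ n) → Carrier)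
    (Φ : (Fin n → Fin (2 ℕ.+ n)) → Carrier) →
    (∀ i j → T i j ≈ T j i) → (∀ {f g} → (∀ r → f r ≡ g r) → Φ f ≈ Φ g) →
    sum (λ j → sum λ k → sign j *
      (sign k * (T j (punchIn j k) * Φ (λ r → punchIn j (punchIn k r))))) ≈ 0#
  laplace²-symmetric {n} T Φ T-sym Φ-cong = begin
    sum (λ k → t zero k) + sum (λ j → t (suc j) zero + sum λ k → t (suc j) (suc k))
      ≈⟨ +-congˡ (∑-distrib-+ (λ j → t (suc j) zero) (λ j → sum λ k → t (suc j) (suc k))) ⟩
    sum (λ k → t zero k) + (sum (λ j → t (suc j) zero) + sum (λ j → sum λ k → t (suc j) (suc k)))
      ≈⟨ sym (+-assoc _ _ _) ⟩
    (sum (λ k → t zero k) + sum (λ j → t (suc j) zero)) + sum (λ j → sum λ k → t (suc j) (suc k))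
      -- The pairs (0 , k + 1) and (k + 1 , 0) cancel one by one. In the rest both indices are
      -- positive, and `inner` reduces that sum to the same statement for one size less.
      ≈⟨ +-cong
           (trans (sym (∑-distrib-+ (t zero) (λ j → t (suc j) zero)))
             (sum-zero (λ k → t zero k + t (suc k) zero) cancel))
           (inner n T Φ T-sym Φ-cong) ⟩
    0# + 0#
      ≈⟨ +-identityˡ 0# ⟩
    0# ∎
    where
    t : Fin (2 ℕ.+ n) → Fin (1 ℕ.+ n) → Carrier
    t j k = sign j * (sign k * (T j (punchIn j k) * Φ (λ r → punchIn j (punchIn k r))))
    cancel : ∀ k → t zero k + t (suc k) zero ≈ 0#
    cancel k = begin
      1# * (sign k * X) + - sign k * (1# * Y)
        ≈⟨ +-cong (*-identityˡ _) (*-congˡ (*-identityˡ Y)) ⟩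
      sign k * X + - sign k * Y
        ≈⟨ +-congˡ (*-congˡ (*-cong (T-sym (suc k) zero) refl)) ⟩
      sign k * X + - sign k * X
        ≈⟨ +-congˡ (sym (-‿distribˡ-* (sign k) X)) ⟩
      sign k * X - sign k * X
        ≈⟨ -‿inverseʳ _ ⟩
      0# ∎
      where
      X = T zero (suc k) * Φ (λ r → suc (punchIn k r))
      Y = T (suc k) zero * Φ (λ r → punchIn (suc k) (suc r))
    inner : ∀ n (T : Fin (2 ℕ.+ n) → Fin (2 ℕ.+ n) → Carrier)
      (Φ : (Fin n → Fin (2 ℕ.+ n)) → Carrier) →
      (∀ i j → T i j ≈ T j i) → (∀ {f g} → (∀ r → f r ≡ g r) → Φ f ≈ Φ g) →
      sum (λ j → sum λ k → sign (suc j) * (sign (suc k) *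
        (T (suc j) (punchIn (suc j) (suc k)) *
          Φ (λ r → punchIn (suc j) (punchIn (suc k) r))))) ≈ 0#
    inner zero    T Φ T-sym Φ-cong = sum-zero {1} _ λ _ → refl
    inner (suc n) T Φ T-sym Φ-cong = trans
      (sum-ext (λ j → sum (f j)) (λ j → sum (g j)) λ j → sum-ext (f j) (g j) λ k → trans
        (neg-neg (sign j) (sign k) _)
        (*-congˡ (*-congˡ (*-congˡ (Φ-cong (same j k))))))
      (laplace²-symmetric (λ i j → T (suc i) (suc j)) (λ f → Φ (lift f))
        (λ i j → T-sym (suc i) (suc j)) (λ h → Φ-cong (lift-cong h)))
      where
      f g : Fin (2 ℕ.+ n) → Fin (1 ℕ.+ n) → Carrier
      f j k = sign (suc j) * (sign (suc k) * (T (suc j) (punchIn (suc j) (suc k)) *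
        Φ (λ r → punchIn (suc j) (punchIn (suc k) r))))
      g j k = sign j * (sign k * (T (suc j) (suc (punchIn j k)) *
        Φ (lift (λ r → punchIn j (punchIn k r)))))
      same : ∀ j k r → punchIn (suc j) (punchIn (suc k) r) ≡ lift (λ r → punchIn j (punchIn k r)) r
      same j k zero    = ≡.refl
      same j k (suc r) = ≡.refl
      neg-neg : ∀ a b x → - a * (- b * x) ≈ a * (b * x)
      neg-neg a b x = begin
        - a * (- b * x)       ≈⟨ *-congˡ (sym (-‿distribˡ-* b x)) ⟩
        - a * - (b * x)       ≈⟨ sym (-‿distribˡ-* a _) ⟩
        - (a * - (b * x))     ≈⟨ -‿cong (sym (-‿distribʳ-* a _)) ⟩
        - - (a * (b * x))     ≈⟨ -‿involutive _ ⟩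
        a * (b * x)           ∎
        where open Algebra.Properties.Ring ring using (-‿involutive)

  private
    -- The minor left after two Laplace steps, as a function of the surviving columns: the shape
    -- that `Φ` has to have.
    belowRows : ∀ {n} → Matrix (2 ℕ.+ n) → (Fin n → Fin (2 ℕ.+ n)) → Carrier
    belowRows M f = det (λ r q → M (suc (suc r)) (f q))

    belowRows-cong : ∀ {n} (M : Matrix (2 ℕ.+ n)) {f g} → (∀ r → f r ≡ g r) →
      belowRows M f ≈ belowRows M g
    belowRows-cong M h = det-cong λ r q → reflexive (≡.cong (M (suc (suc r))) (h q))

    laplace² : ∀ {n} → Matrix (2 ℕ.+ n) → Fin (2 ℕ.+ n) → Fin (1 ℕ.+ n) → Carrier
    laplace² M j k = sign j * (sign k * (M zero j * M (suc zero) (punchIn j k) *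
      belowRows M (λ r → punchIn j (punchIn k r))))

    det-laplace² : ∀ {n} (M : Matrix (2 ℕ.+ n)) → det M ≈ sum (λ j → sum (laplace² M j))
    det-laplace² M = sum-ext (laplace M) (λ j → sum (laplace² M j)) λ j →
      trans (*-distribˡ-sum (sign j * M zero j) (laplace (minor M j)))
        (sum-ext (λ k → sign j * M zero j * laplace (minor M j) k) (laplace² M j) λ k →
          eq (sign j) (M zero j) (sign k) (M (suc zero) (punchIn j k))
            (belowRows M (λ r → punchIn j (punchIn k r))))
      where
      eq : ∀ s m t m′ D → s * m * (t * m′ * D) ≈ s * (t * (m * m′ * D))
      eq = solve 5 (λ s m t m′ D → s :* m :* (t :* m′ :* D) := s :* (t :* (m :* m′ :* D))) refl

  -- Equal rows make the coefficient `M zero i * M (suc zero) j` symmetric in i and j.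
  det-rows01-equal : ∀ {n} (M : Matrix (2 ℕ.+ n)) →
    (∀ j → M zero j ≈ M (suc zero) j) → det M ≈ 0#
  det-rows01-equal M h = trans (det-laplace² M)
    (laplace²-symmetric (λ i j → M zero i * M (suc zero) j) (belowRows M)
      (λ i j → trans (*-cong (h i) (sym (h j))) (*-comm _ _)) (belowRows-cong M))

  -- Adding the two double expansions symmetrises the coefficient of each column pair, which puts
  -- the sum into the vanishing form.
  det-swap01 : ∀ {n} {M N : Matrix (2 ℕ.+ n)} →
    (∀ j → M zero j ≈ N (suc zero) j) → (∀ j → M (suc zero) j ≈ N zero j) →
    (∀ i j → M (suc (suc i)) j ≈ N (suc (suc i)) j) → det M + det N ≈ 0#
  det-swap01 {n} {M} {N} h₀ h₁ h = begin
    det M + det N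
      ≈⟨ +-cong (det-laplace² M) (det-laplace² N) ⟩
    sum (λ j → sum (laplace² M j)) + sum (λ j → sum (laplace² N j))
      ≈⟨ sym (∑-distrib-+ (λ j → sum (laplace² M j)) (λ j → sum (laplace² N j))) ⟩
    sum (λ j → sum (laplace² M j) + sum (laplace² N j))
      ≈⟨ sum-ext (λ j → sum (laplace² M j) + sum (laplace² N j)) (λ j → sum (t j)) (λ j → trans
           (sym (∑-distrib-+ (laplace² M j) (laplace² N j)))
           (sum-ext (λ k → laplace² M j k + laplace² N j k) (t j) λ k → trans
             (+-congˡ (*-congˡ (*-congˡ (*-cong
               (*-cong (sym (h₁ j)) (sym (h₀ (punchIn j k))))
               (det-cong λ i q → sym (h i (punchIn j (punchIn k q))))))))
             (eq (sign j) (sign k) (M zero j) (M (suc zero) (punchIn j k)) _ _ _))) ⟩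
    sum (λ j → sum (t j))
      ≈⟨ laplace²-symmetric T (belowRows M) (λ i j → trans (+-comm _ _) (+-cong (*-comm _ _) (*-comm _ _)))
           (belowRows-cong M) ⟩
    0# ∎
    where
    T : Fin (2 ℕ.+ n) → Fin (2 ℕ.+ n) → Carrier
    T i j = M zero i * M (suc zero) j + M (suc zero) i * M zero j
    t : Fin (2 ℕ.+ n) → Fin (1 ℕ.+ n) → Carrier
    t j k = sign j * (sign k * (T j (punchIn j k) *
      belowRows M (λ r → punchIn j (punchIn k r))))
    eq : ∀ s t a b c d D → s * (t * (a * b * D)) + s * (t * (c * d * D)) ≈ s * (t * ((a * b + c * d) * D))
    eq = solve 7 (λ s t a b c d D →
      s :* (t :* (a :* b :* D)) :+ s :* (t :* (c :* d :* D)) := s :* (t :* ((a :* b :+ c :* d) :* D))) refl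

  swap01 : ∀ {n} → Matrix (2 ℕ.+ n) → Matrix (2 ℕ.+ n)
  swap01 M zero          = M (suc zero)
  swap01 M (suc zero)    = M zero
  swap01 M (suc (suc i)) = M (suc (suc i))

  private
    module _ {n} (ih : ∀ (M : Matrix n) {p q} → p ≢ q → (∀ j → M p j ≈ M q j) → det M ≈ 0#) where

      alternating-below : ∀ (M : Matrix (suc n)) {p q : Fin n} → p ≢ q →
        (∀ j → M (suc p) j ≈ M (suc q) j) → det M ≈ 0#
      alternating-below M {p} {q} p≢q h = sum-zero (laplace M) λ j → trans
        (*-congˡ (ih (minor M j) p≢q (λ k → h (punchIn j k))))
        (zeroʳ (sign j * M zero j))

    -- Unless the equal rows are the first two, exchanging rows 0 and 1 moves both of them below the
    -- first row, where the hypothesis on minors applies.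
    alternating-first : ∀ {n} → (∀ (M : Matrix n) {p q} → p ≢ q → (∀ j → M p j ≈ M q j) → det M ≈ 0#) →
      ∀ (M : Matrix (suc n)) (q : Fin n) → (∀ j → M zero j ≈ M (suc q) j) → det M ≈ 0#
    alternating-first ih M zero    h = det-rows01-equal M h
    alternating-first ih M (suc q) h = begin
      det M                      ≈⟨ sym (+-identityʳ _) ⟩
      det M + 0#
        ≈⟨ +-congˡ (sym (alternating-below ih (swap01 M) {zero} {suc q} (λ ()) h)) ⟩
      det M + det (swap01 M)
        ≈⟨ det-swap01 {M = M} {N = swap01 M} (λ _ → refl) (λ _ → refl) (λ _ _ → refl) ⟩
      0#                         ∎

  det-alternating : ∀ {n} (M : Matrix n) {p q} → p ≢ q → (∀ j → M p j ≈ M q j) → det M ≈ 0#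
  det-alternating {suc n} M {zero}  {zero}  p≢q h = contradiction ≡.refl p≢q
  det-alternating {suc n} M {zero}  {suc q} p≢q h = alternating-first det-alternating M q h
  det-alternating {suc n} M {suc p} {zero}  p≢q h =
    alternating-first det-alternating M p (λ j → sym (h j))
  det-alternating {suc n} M {suc p} {suc q} p≢q h =
    alternating-below det-alternating M (p≢q ∘ ≡.cong suc) h

-- Cofactors and the adjugate identity

module CharacteristicPolynomials {c ℓ} (R : CommutativeRing c ℓ) where

  open CommutativeRing R hiding (zero)
  open Matrices rawRing
  open PolynomialFunctions R
  open Determinants R
  open Algebra.Properties.Ring ring using (-‿distribˡ-*)
  open Algebra.Properties.Semiring.Sum semiring
    using (sum-cong-≋; ∑-distrib-+; ∑-comm; *-distribˡ-sum; *-distribʳ-sum)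
  open import Algebra.Solver.Ring.NaturalCoefficients.Default commutativeSemiring
    using (solve; _:+_; _:*_; _:=_)
  open import Relation.Binary.Reasoning.Setoid setoid

  infixl 9 _[_]≔_
  _[_]≔_ : ∀ {m n} → (Fin m → Fin n → Carrier) → Fin m → (Fin n → Carrier) → Fin m → Fin n → Carrier
  M [ p ]≔ v = updateAt M p (const v)

  -- Identifies a minor of an updated matrix with an update of the minor.
  []≔-∘ : ∀ {m n k} (M : Fin m → Fin n → Carrier) p v (π : Fin k → Fin n) i j →
    (M [ p ]≔ v) i (π j) ≡ ((λ r → M r ∘ π) [ p ]≔ (v ∘ π)) i j
  []≔-∘ M zero    v π zero    j = ≡.refl
  []≔-∘ M zero    v π (suc i) j = ≡.refl
  []≔-∘ M (suc p) v π zero    j = ≡.refl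
  []≔-∘ M (suc p) v π (suc i) j = []≔-∘ (M ∘ suc) p v π i j

  []≔-hit : ∀ {m n} (M : Fin m → Fin n → Carrier) p v j → (M [ p ]≔ v) p j ≈ v j
  []≔-hit M p v j = reflexive (≡.cong-app (updateAt-updates p M) j)

  []≔-miss : ∀ {m n} (M : Fin m → Fin n → Carrier) p v i → i ≢ p → ∀ j → (M [ p ]≔ v) i j ≈ M i j
  []≔-miss M p v i i≢p j = reflexive (≡.cong-app (updateAt-minimal i p M i≢p) j)

  []≔-cong : ∀ {m n} (M : Fin m → Fin n → Carrier) p {u v} → (∀ j → u j ≈ v j) →
    ∀ i j → (M [ p ]≔ u) i j ≈ (M [ p ]≔ v) i j
  []≔-cong M zero    h zero    j = h j
  []≔-cong M zero    h (suc i) j = refl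
  []≔-cong M (suc p) h zero    j = refl
  []≔-cong M (suc p) h (suc i) j = []≔-cong (M ∘ suc) p h i j

  linear-expand : ∀ {n} (F : Vector Carrier n → Carrier) →
    (∀ {u v} → (∀ j → u j ≈ v j) → F u ≈ F v) →
    (∀ u v a → F (λ j → u j + a * v j) ≈ F u + a * F v) →
    ∀ v → F v ≈ sum (λ j → v j * F (scalar 1# j))
  -- Without coordinates the sum is empty, and F v = 0 comes from linearity with u = v and a = -1.
  linear-expand {zero} F F-cong F-lin v = begin
    F v                             ≈⟨ F-cong (λ ()) ⟩
    F (λ j → v j + - 1# * v j)      ≈⟨ F-lin v v (- 1#) ⟩
    F v + - 1# * F v                ≈⟨ +-congˡ (sym (-‿distribˡ-* 1# (F v))) ⟩
    F v - 1# * F v                  ≈⟨ +-congˡ (-‿cong (*-identityˡ (F v))) ⟩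
    F v - F v                       ≈⟨ -‿inverseʳ (F v) ⟩
    0#                              ∎
  linear-expand {suc n} F F-cong F-lin v = begin
    F v
      ≈⟨ F-cong split ⟩
    F (λ j → (0# ∷ (v ∘ suc)) j + v zero * scalar 1# zero j)
      ≈⟨ F-lin _ _ (v zero) ⟩
    F (0# ∷ (v ∘ suc)) + v zero * F (scalar 1# zero)
      ≈⟨ +-comm _ _ ⟩
    v zero * F (scalar 1# zero) + F (0# ∷ (v ∘ suc))
      ≈⟨ +-congˡ (linear-expand (λ w → F (0# ∷ w)) (λ h → F-cong (∷-cong h)) lin (v ∘ suc)) ⟩
    v zero * F (scalar 1# zero) + sum (λ j → v (suc j) * F (0# ∷ scalar 1# j))
      ≈⟨ +-congˡ (sum-ext (λ j → v (suc j) * F (0# ∷ scalar 1# j))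
           (λ j → v (suc j) * F (scalar 1# (suc j)))
           λ j → *-congˡ (F-cong (λ { zero → refl ; (suc k) → refl }))) ⟩
    sum (λ j → v j * F (scalar 1# j)) ∎
    where
    ∷-cong : ∀ {u w : Vector Carrier n} → (∀ j → u j ≈ w j) → ∀ j → (0# ∷ u) j ≈ (0# ∷ w) j
    ∷-cong h zero    = refl
    ∷-cong h (suc j) = h j
    split : ∀ j → v j ≈ (0# ∷ (v ∘ suc)) j + v zero * scalar 1# zero j
    split zero    = sym (trans (+-identityˡ _) (*-identityʳ _))
    split (suc j) = sym (trans (+-congˡ (zeroʳ _)) (+-identityʳ _))
    lin : ∀ u w a → F (0# ∷ (λ j → u j + a * w j)) ≈ F (0# ∷ u) + a * F (0# ∷ w)
    lin u w a = trans
      (F-cong (λ { zero → sym (trans (+-identityˡ _) (zeroʳ a)) ; (suc j) → refl }))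
      (F-lin (0# ∷ u) (0# ∷ w) a)

  -- Inserting a unit vector yields the signed minor without a sign or a deletion, and expansion
  -- along any row becomes an instance of linearity.
  cofactor : ∀ {n} → Matrix n → Fin n → Fin n → Carrier
  cofactor M p j = det (M [ p ]≔ scalar 1# j)

  cofactor-expand : ∀ {n} (M : Matrix n) p v → det (M [ p ]≔ v) ≈ sum (λ j → v j * cofactor M p j)
  cofactor-expand M p = linear-expand (λ v → det (M [ p ]≔ v))
    (λ h → det-cong ([]≔-cong M p h))
    (λ u v a → det-linear p
      (λ j → trans ([]≔-hit M p _ j)
        (sym (+-cong ([]≔-hit M p u j) (*-congˡ ([]≔-hit M p v j)))))
      (λ i i≢p j → trans ([]≔-miss M p _ i i≢p j) (sym ([]≔-miss M p u i i≢p j)))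
      (λ i i≢p j → trans ([]≔-miss M p _ i i≢p j) (sym ([]≔-miss M p v i i≢p j))))

  -- The sum is the determinant with row p overwritten by row k: that of `M` itself if k = p, and of
  -- a matrix with two equal rows otherwise.
  adjugate : ∀ {n} (M : Matrix n) k p →
    sum (λ j → M k j * cofactor M p j) ≈ scalar (det M) k p
  adjugate M k p = trans (sym (cofactor-expand M p (M k))) (case (k ≟ᶠ p))
    where
    case : (d : Dec (k ≡ p)) → det (M [ p ]≔ M k) ≈ (if does d then det M else 0#)
    case (yes ≡.refl) = det-cong λ i j →
      reflexive (≡.cong-app (updateAt-id-local p M ≡.refl i) j)
    case (no k≢p) = det-alternating (M [ p ]≔ M k) {k} {p} k≢p λ j →
      trans ([]≔-miss M p (M k) k k≢p j) (sym ([]≔-hit M p (M k) j))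

  sum-scalar : ∀ {n} a (i : Fin n) (f : Fin n → Carrier) → sum (λ k → scalar a i k * f k) ≈ a * f i
  sum-scalar a zero    f = trans
    (+-congˡ (sum-zero (λ k → scalar a zero (suc k) * f (suc k)) (λ k → zeroˡ _)))
    (+-identityʳ _)
  sum-scalar a (suc i) f = trans (+-cong (zeroˡ _) (sum-scalar a i (f ∘ suc))) (+-identityˡ _)

  scalar-sym : ∀ {n} a (i j : Fin n) → scalar a i j ≈ scalar a j i
  scalar-sym a zero    zero    = refl
  scalar-sym a zero    (suc j) = refl
  scalar-sym a (suc i) zero    = refl
  scalar-sym a (suc i) (suc j) = scalar-sym a i j

  -- Degrees and derivatives of determinants

  Deg≤ : ℕ → (Carrier → Carrier) → Set (c ⊔ ℓ)
  Deg≤ d f = ∃ λ a → Deg d a f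

  deg≤-sum : ∀ d {n} {f : Fin n → Carrier → Carrier} →
    (∀ j → Deg≤ d (f j)) → Deg≤ d (λ x → sum (λ j → f j x))
  deg≤-sum d h = _ , deg-sum d (λ j → proj₂ (h j))

  deg≤-* : ∀ d e {f g} → Deg≤ d f → Deg≤ e g → Deg≤ (d ℕ.+ e) (λ x → f x * g x)
  deg≤-* d e (_ , h) (_ , k) = _ , deg-* d e h k

  deg≤-scale : ∀ d k {f} → Deg≤ d f → Deg≤ d (λ x → k * f x)
  deg≤-scale d k (_ , h) = _ , deg-scale d k h

  deg-det : ∀ {n} (M : Carrier → Matrix n) → (∀ i j → Deg≤ 1 (λ x → M x i j)) →
    Deg≤ n (λ x → det (M x))
  deg-det {zero}  M h = 1# , λ _ → refl
  deg-det {suc n} M h = deg≤-sum (suc n) λ j →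
    deg≤-* 1 n (deg≤-scale 1 (sign j) (h zero j))
      (deg-det (λ x → minor (M x) j) (λ i k → h (suc i) (punchIn j k)))

  -- The constant row costs one degree. In a cofactor the inserted unit vector is such a row, which
  -- keeps it below the degree of the characteristic polynomial.
  deg-det-const-row : ∀ {n} (M : Carrier → Matrix (suc n)) p →
    (∀ i → i ≢ p → ∀ j → Deg≤ 1 (λ x → M x i j)) → (∀ j → Deg≤ 0 (λ x → M x p j)) →
    Deg≤ n (λ x → det (M x))
  deg-det-const-row {n} M zero h k = deg≤-sum n λ j →
    deg≤-* 0 n (deg≤-scale 0 (sign j) (k j))
      (deg-det (λ x → minor (M x) j) (λ i l → h (suc i) (λ ()) (punchIn j l)))
  deg-det-const-row {suc n} M (suc p) h k = deg≤-sum (suc n) λ j →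
    deg≤-* 1 n (deg≤-scale 1 (sign j) (h zero (λ ()) j))
      (deg-det-const-row (λ x → minor (M x) j) p
        (λ i i≢p l → h (suc i) (i≢p ∘ suc-injective) (punchIn j l))
        (λ l → k (punchIn j l)))

  charMatrix : ∀ {n} → Matrix n → Carrier → Matrix n
  charMatrix A x i j = scalar x i j + - A i j

  charMatrix-deg : ∀ {n} (A : Matrix n) i j → Deg≤ 1 (λ x → charMatrix A x i j)
  charMatrix-deg A zero    zero    = 1# , deg-shift (A zero zero)
  charMatrix-deg A zero    (suc j) = 0# , deg-raise 0 (λ _ → refl)
  charMatrix-deg A (suc i) zero    = 0# , deg-raise 0 (λ _ → refl)
  charMatrix-deg A (suc i) (suc j) = charMatrix-deg (λ i j → A (suc i) (suc j)) i j

  -- Only the first Laplace term reaches the top degree; in the others the entry from the first row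
  -- does not depend on x.
  charPoly-monic : ∀ {n} (A : Matrix n) → Deg n 1# (charPoly A)
  charPoly-monic {zero}  A = λ _ → refl
  charPoly-monic {suc n} A =
    deg-cong (suc n)
      (trans (+-cong (trans (*-identityʳ _) (*-identityʳ _)) (sum-zero {n} _ (λ _ → refl)))
        (+-identityʳ 1#))
      (λ _ → refl)
      (deg-+ (suc n)
        (deg-* 1 n (deg-scale 1 1# (deg-shift (A zero zero)))
          (charPoly-monic (λ i j → A (suc i) (suc j))))
        (deg-sum (suc n) λ j → deg-raise n (proj₂ (off j))))
    where
    off : ∀ j → Deg≤ n (λ x → laplace (charMatrix A x) (suc j))
    off j = deg≤-* 0 n {λ x → sign (suc j) * charMatrix A x zero (suc j)}
      (deg≤-scale 0 (sign (suc j)) (_ , λ _ → refl))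
      (deg-det (λ x → minor (charMatrix A x) (suc j))
        (λ i k → charMatrix-deg A (suc i) (punchIn (suc j) k)))

  cofactor-deg : ∀ {n} (A : Matrix (suc n)) p j → Deg≤ n (λ x → cofactor (charMatrix A x) p j)
  cofactor-deg A p j = deg-det-const-row (λ x → charMatrix A x [ p ]≔ scalar 1# j) p
    (λ i i≢p k → let a , h = charMatrix-deg A i k in
      a , deg-cong 1 refl (λ x → sym ([]≔-miss (charMatrix A x) p _ i i≢p k)) h)
    (λ k → scalar 1# j k , λ x → []≔-hit (charMatrix A x) p _ k)

  -- The product rule on the Laplace expansion gives the term for row 0 at once; the derivatives of
  -- the minors become the terms for the other rows after the sums over columns and rows are
  -- exchanged.
  deriv-det : ∀ {n} (M : Carrier → Matrix n) (E : Matrix n) p →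
    (∀ i j → Deriv p (λ x → M x i j) (E i j)) →
    Deriv p (λ x → det (M x)) (sum (λ i → det (M p [ i ]≔ E i)))
  deriv-det {zero}  M E p h = deriv-const 1#
  deriv-det {suc n} M E p h = deriv-cong eq
    (deriv-sum λ j → deriv-* (deriv-* (deriv-const (sign j)) (h zero j))
      (deriv-det (λ x → minor (M x) j) (minor E j) p (λ i k → h (suc i) (punchIn j k))))
    where
    D : Fin (suc n) → Carrier
    D j = det (minor (M p) j)
    S : Fin (suc n) → Fin n → Carrier
    S j i = det (minor (M p) j [ i ]≔ minor E j i)
    first rest : Fin (suc n) → Carrier
    first j = sign j * E zero j * D j
    rest j  = sign j * M p zero j * sum (S j)
    expand : Fin n → Fin (suc n) → Carrier
    expand i j = sign j * M p zero j * S j i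
    eq : sum (λ j → (0# * M p zero j + sign j * E zero j) * D j + sign j * M p zero j * sum (S j))
       ≈ sum (λ i → det (M p [ i ]≔ E i))
    eq = begin
      sum (λ j → (0# * M p zero j + sign j * E zero j) * D j + rest j)
        ≈⟨ sum-ext (λ j → (0# * M p zero j + sign j * E zero j) * D j + rest j) (λ j → first j + rest j)
             (λ j → +-congʳ (*-congʳ (trans (+-congʳ (zeroˡ _)) (+-identityˡ _)))) ⟩
      sum (λ j → first j + rest j)
        ≈⟨ ∑-distrib-+ first rest ⟩
      sum first + sum rest
        ≈⟨ +-congˡ (sum-ext rest (λ j → sum (λ i → expand i j))
             (λ j → *-distribˡ-sum (sign j * M p zero j) (S j))) ⟩
      sum first + sum (λ j → sum (λ i → expand i j))
        ≈⟨ +-congˡ (∑-comm (λ j i → expand i j)) ⟩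
      sum first + sum (λ i → sum (expand i))
        ≈⟨ +-congˡ (sum-ext (λ i → sum (expand i)) (λ i → det (M p [ suc i ]≔ E (suc i)))
             λ i → sum-ext (expand i) (laplace (M p [ suc i ]≔ E (suc i))) λ j →
               *-congˡ (det-cong λ r k → sym (reflexive
                 ([]≔-∘ (M p ∘ suc) i (E (suc i)) (punchIn j) r k)))) ⟩
      sum (λ i → det (M p [ i ]≔ E i)) ∎

  charMatrix-deriv : ∀ {n} (A : Matrix n) p i j →
    Deriv p (λ x → charMatrix A x i j) (scalar 1# i j)
  charMatrix-deriv A p zero    zero    = (λ _ → 1#) , poly-const 1# ,
    (λ x → begin
      x + - a                   ≈⟨ +-congʳ (x-p+p x p) ⟩
      (x - p) + p + - a         ≈⟨ +-assoc _ _ _ ⟩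
      (x - p) + (p + - a)       ≈⟨ +-comm _ _ ⟩
      (p + - a) + (x - p)       ≈⟨ +-congˡ (sym (*-identityʳ _)) ⟩
      (p + - a) + (x - p) * 1#  ∎) , refl
    where a = A zero zero
  charMatrix-deriv A p zero    (suc j) = deriv-const _
  charMatrix-deriv A p (suc i) zero    = deriv-const _
  charMatrix-deriv A p (suc i) (suc j) = charMatrix-deriv (λ i j → A (suc i) (suc j)) p i j

  -- Traces of powers from the characteristic polynomial

  pow : ∀ {n} → Matrix n → ℕ → Matrix n
  pow A zero    = scalar 1#
  pow A (suc m) i j = sum (λ k → pow A m i k * A k j)

  trace : ∀ {n} → Matrix n → Carrier
  trace A = sum (λ i → A i i)

  -- The trace of A ^ m · adj (x I − A): the cofactors are not transposed,
  -- as the (k , i) entry of the adjugate is cofactor i k.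
  adjTrace : ∀ {n} → Matrix n → ℕ → Carrier → Carrier
  adjTrace A m x = sum (λ i → sum (λ k → pow A m i k * cofactor (charMatrix A x) i k))

  adjTrace-deg : ∀ {n} (A : Matrix (suc n)) m → Deg≤ n (adjTrace A m)
  adjTrace-deg {n} A m = deg≤-sum n λ i → deg≤-sum n λ k →
    deg≤-scale n (pow A m i k) (cofactor-deg A i k)

  -- As x I - A has derivative I, the rows inserted by `deriv-det` are unit vectors, and its sum
  -- runs over the diagonal cofactors, which `pow A 0` selects.
  adjTrace-zero : ∀ {n} (A : Matrix n) p → Deriv p (charPoly A) (adjTrace A 0 p)
  adjTrace-zero A p = deriv-cong
    (sum-cong-≋ λ i → sym (trans (sum-scalar 1# i (cofactor (charMatrix A p) i)) (*-identityˡ _)))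
    (deriv-det (charMatrix A) (scalar 1#) p (charMatrix-deriv A p))

  -- The adjugate identity reads x adj = A adj + P I with adj = adj (x I - A); multiply by A^m and
  -- take traces.
  adjTrace-suc : ∀ {n} (A : Matrix n) m x →
    x * adjTrace A m x ≈ adjTrace A (suc m) x + trace (pow A m) * charPoly A x
  adjTrace-suc {n} A m x = begin
    x * sum (λ i → sum (λ k → B i k * N i k))
      ≈⟨ *-distribˡ-sum x (λ i → sum (λ k → B i k * N i k)) ⟩
    sum (λ i → x * sum (λ k → B i k * N i k))
      ≈⟨ sum-cong-≋ row ⟩
    sum (λ i → sum (λ j → pow A (suc m) i j * N i j) + B i i * P)
      ≈⟨ ∑-distrib-+ (λ i → sum (λ j → pow A (suc m) i j * N i j)) (λ i → B i i * P) ⟩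
    adjTrace A (suc m) x + sum (λ i → B i i * P)
      ≈⟨ +-congˡ (sym (*-distribʳ-sum P (λ i → B i i))) ⟩
    adjTrace A (suc m) x + trace B * P ∎
    where
    B = pow A m
    N = cofactor (charMatrix A x)
    P = charPoly A x
    resolvent : ∀ i k → x * N i k ≈ sum (λ j → A k j * N i j) + scalar P k i
    resolvent i k = begin
      x * N i k
        ≈⟨ sym (sum-scalar x k (N i)) ⟩
      sum (λ j → scalar x k j * N i j)
        ≈⟨ sum-cong-≋ (λ j → trans (*-congʳ (x-p+p (scalar x k j) (A k j)))
             (trans (distribʳ _ _ _) (+-comm _ _))) ⟩
      sum (λ j → A k j * N i j + charMatrix A x k j * N i j)
        ≈⟨ ∑-distrib-+ (λ j → A k j * N i j) (λ j → charMatrix A x k j * N i j) ⟩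
      sum (λ j → A k j * N i j) + sum (λ j → charMatrix A x k j * N i j)
        ≈⟨ +-congˡ (adjugate (charMatrix A x) k i) ⟩
      sum (λ j → A k j * N i j) + scalar P k i ∎
    comm₁ : ∀ a b d → a * (b * d) ≈ b * (a * d)
    comm₁ = solve 3 (λ a b d → a :* (b :* d) := b :* (a :* d)) refl
    row : ∀ i → x * sum (λ k → B i k * N i k) ≈
      sum (λ j → pow A (suc m) i j * N i j) + B i i * P
    row i = begin
      x * sum (λ k → B i k * N i k)
        ≈⟨ *-distribˡ-sum x (λ k → B i k * N i k) ⟩
      sum (λ k → x * (B i k * N i k))
        ≈⟨ sum-cong-≋ (λ k → trans (comm₁ x (B i k) (N i k))
             (trans (*-congˡ (resolvent i k)) (distribˡ _ _ _))) ⟩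
      sum (λ k → B i k * sum (λ j → A k j * N i j) + B i k * scalar P k i)
        ≈⟨ ∑-distrib-+ (λ k → B i k * sum (λ j → A k j * N i j)) (λ k → B i k * scalar P k i) ⟩
      sum (λ k → B i k * sum (λ j → A k j * N i j)) + sum (λ k → B i k * scalar P k i)
        ≈⟨ +-cong
             (trans (sum-cong-≋ (λ k → *-distribˡ-sum (B i k) (λ j → A k j * N i j)))
               (trans (∑-comm (λ k j → B i k * (A k j * N i j)))
                 (sum-cong-≋ λ j → trans
                   (sum-cong-≋ (λ k → sym (*-assoc (B i k) (A k j) (N i j))))
                   (sym (*-distribʳ-sum (N i j) (λ k → B i k * A k j))))))
             (trans (sum-cong-≋ (λ k → trans (*-comm _ _) (*-congʳ (scalar-sym P k i))))
               (trans (sum-scalar P i (B i)) (*-comm _ _))) ⟩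
      sum (λ j → pow A (suc m) i j * N i j) + B i i * P ∎

  module _ (inv : NatsInvertible) {n} (A B : Matrix (suc n))
    (same : ∀ x → charPoly A x ≈ charPoly B x) where

    private
      -x : ∀ x → - 1# * x ≈ - x
      -x x = trans (sym (-‿distribˡ-* 1# x)) (-‿cong (*-identityˡ x))

      x-y≈0⇒x≈y : ∀ {x y} → x - y ≈ 0# → x ≈ y
      x-y≈0⇒x≈y {x} {y} h = trans (x-p+p x y) (trans (+-congʳ h) (+-identityˡ y))

    -- Two divisions of the same polynomial x Q_m by P, with the trace as quotient and Q_{m+1} as
    -- remainder. Their difference `f` vanishes and has leading coefficient `tA - tB`: the quotients
    -- agree, and then the remainders do.
    newton-step : ∀ m → (∀ x → adjTrace A m x ≈ adjTrace B m x) →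
      trace (pow A m) ≈ trace (pow B m) × (∀ x → adjTrace A (suc m) x ≈ adjTrace B (suc m) x)
    newton-step m h = tA≈tB , λ x →
      x-y≈0⇒x≈y (begin
        QA x - QB x                        ≈⟨ sym (+-identityʳ _) ⟩
        (QA x - QB x) + 0#                 ≈⟨ +-congˡ (sym (zeroˡ _)) ⟩
        (QA x - QB x) + 0# * charPoly A x  ≈⟨ +-congˡ (*-congʳ (sym t≈0)) ⟩
        f x                                ≈⟨ f≈0 x ⟩
        0#                                 ∎)
      where
      QA = adjTrace A (suc m)
      QB = adjTrace B (suc m)
      tA = trace (pow A m)
      tB = trace (pow B m)
      f : Carrier → Carrier
      f x = (QA x - QB x) + (tA - tB) * charPoly A x
      f-deg : Deg (suc n) (tA - tB) f
      f-deg = deg-cong (suc n) (trans (+-identityˡ _) (*-identityʳ _))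
        (λ x → +-congʳ (+-congˡ (-x (QB x))))
        (deg-+ (suc n)
          (deg-raise n (deg-+ n (proj₂ (adjTrace-deg A (suc m)))
            (deg-scale n (- 1#) (proj₂ (adjTrace-deg B (suc m))))))
          (deg-scale (suc n) (tA - tB) (charPoly-monic A)))
      f≈0 : ∀ x → f x ≈ 0#
      f≈0 x = begin
        (QA x - QB x) + (tA - tB) * P    ≈⟨ +-congˡ (distribʳ P tA (- tB)) ⟩
        (QA x - QB x) + (tA * P + - tB * P)
          ≈⟨ eq (QA x) (- QB x) (tA * P) (- tB * P) ⟩
        (QA x + tA * P) + (- QB x + - tB * P)
          ≈⟨ +-cong (sym (adjTrace-suc A m x)) (+-cong (sym (-x (QB x)))
               (trans (sym (-‿distribˡ-* tB P)) (trans (sym (-x (tB * P))) (*-congˡ (*-congˡ (same x)))))) ⟩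
        x * adjTrace A m x + (- 1# * QB x + - 1# * (tB * charPoly B x))
          ≈⟨ +-cong (*-congˡ (h x)) (sym (distribˡ (- 1#) _ _)) ⟩
        x * adjTrace B m x + - 1# * (QB x + tB * charPoly B x)
          ≈⟨ +-congˡ (*-congˡ (sym (adjTrace-suc B m x))) ⟩
        x * adjTrace B m x + - 1# * (x * adjTrace B m x)
          ≈⟨ +-congˡ (-x _) ⟩
        x * adjTrace B m x - x * adjTrace B m x
          ≈⟨ -‿inverseʳ _ ⟩
        0# ∎
        where
        P = charPoly A x
        eq : ∀ a b d e → (a + b) + (d + e) ≈ (a + d) + (b + e)
        eq = solve 4 (λ a b d e → (a :+ b) :+ (d :+ e) := (a :+ d) :+ (b :+ e)) refl
      t≈0 : tA - tB ≈ 0#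
      t≈0 = proj₁ (deg-vanish inv (suc n) f-deg 0# 0 (λ j → f≈0 _))
      tA≈tB : tA ≈ tB
      tA≈tB = x-y≈0⇒x≈y t≈0

    adjTrace-same : ∀ m x → adjTrace A m x ≈ adjTrace B m x
    adjTrace-same zero    p = deriv-unique inv same (adjTrace-zero A p) (adjTrace-zero B p)
    adjTrace-same (suc m) = proj₂ (newton-step m (adjTrace-same m))

    charPoly-same⇒trace-same : ∀ m → trace (pow A m) ≈ trace (pow B m)
    charPoly-same⇒trace-same m = proj₁ (newton-step m (adjTrace-same m))

  diagonal : ∀ {n} → Vector Carrier n → Matrix n
  diagonal μ i = scalar (μ i) i

  charPoly-diagonal : ∀ {n} (μ : Vector Carrier n) x →
    charPoly (diagonal μ) x ≈ product (λ i → x + - μ i)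
  charPoly-diagonal {zero}  μ x = refl
  charPoly-diagonal {suc n} μ x = trans
    (+-cong (*-cong (*-identityˡ _) (charPoly-diagonal (μ ∘ suc) x))
      (sum-zero (λ j → laplace (charMatrix (diagonal μ) x) (suc j)) λ j →
        trans (*-congʳ (trans (*-congˡ (-‿inverseʳ 0#)) (zeroʳ _))) (zeroˡ _)))
    (+-identityʳ _)

  open import Algebra.Definitions.RawSemiring (RawRing.rawSemiring rawRing) using (_^_)

  pow-diagonal : ∀ {n} (μ : Vector Carrier n) m i j → pow (diagonal μ) m i j ≈ scalar (μ i ^ m) i j
  pow-diagonal μ zero    i j = refl
  pow-diagonal μ (suc m) i j = begin
    sum (λ k → pow (diagonal μ) m i k * diagonal μ k j)
      ≈⟨ sum-cong-≋ (λ k → *-congʳ (pow-diagonal μ m i k)) ⟩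
    sum (λ k → scalar (μ i ^ m) i k * scalar (μ k) k j)
      ≈⟨ sum-scalar (μ i ^ m) i (λ k → scalar (μ k) k j) ⟩
    μ i ^ m * scalar (μ i) i j
      ≈⟨ trans (*-scalar i j) (scalar-cong (*-comm _ _) i j) ⟩
    scalar (μ i ^ suc m) i j ∎
    where
    scalar-cong : ∀ {n} {a b} → a ≈ b → (i j : Fin n) → scalar a i j ≈ scalar b i j
    scalar-cong h zero    zero    = h
    scalar-cong h zero    (suc j) = refl
    scalar-cong h (suc i) zero    = refl
    scalar-cong h (suc i) (suc j) = scalar-cong h i j
    *-scalar : ∀ {n} {a b} (i j : Fin n) → a * scalar b i j ≈ scalar (a * b) i j
    *-scalar zero    zero    = refl
    *-scalar zero    (suc j) = zeroʳ _
    *-scalar (suc i) zero    = zeroʳ _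
    *-scalar (suc i) (suc j) = *-scalar i j

  scalar-diag : ∀ {n} a (i : Fin n) → scalar a i i ≈ a
  scalar-diag a zero    = refl
  scalar-diag a (suc i) = scalar-diag a i

  spectrum⇒trace : NatsInvertible → ∀ {n} (A : Matrix (suc n)) μ → IsSpectrum A μ →
    ∀ m → trace (pow A m) ≈ sum (λ i → μ i ^ m)
  spectrum⇒trace inv A μ h m = trans
    (charPoly-same⇒trace-same inv A (diagonal μ)
      (λ x → trans (h x) (sym (charPoly-diagonal μ x))) m)
    (sum-ext (λ i → pow (diagonal μ) m i i) (λ i → μ i ^ m) λ i →
      trans (pow-diagonal μ m i i) (scalar-diag (μ i ^ m) i))

-- Naturals inside the rationals

module Rationals where

  open import Data.Integer.Base using (+_)
  open import Data.Rational.Base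
  open ℚ-Solver using (solve; _:+_; _:-_; :-_; _:=_)
  open ≡ using (refl; sym; cong; subst)

  ι : ℕ → ℚ
  ι n = + n / 1

  private
    toℚᵘ-ι : ∀ n → toℚᵘ (ι n) ℚᵘ.≃ ℚᵘ.mkℚᵘ (+ n) 0
    toℚᵘ-ι n = ℚₚ.toℚᵘ-fromℚᵘ (ℚᵘ.mkℚᵘ (+ n) 0)

  -- Sums in ℚ are reduced to lowest terms, so the identity is checked among unnormalised fractions
  -- with denominator 1.
  ι-+ : ∀ m n → ι (m ℕ.+ n) ≡ ι m + ι n
  ι-+ m n = ℚₚ.toℚᵘ-injective (begin
    toℚᵘ (ι (m ℕ.+ n))                     ≈⟨ toℚᵘ-ι (m ℕ.+ n) ⟩
    ℚᵘ.mkℚᵘ (+ (m ℕ.+ n)) 0                ≈⟨ ℚᵘ.*≡* (cong (ℤ._* + 1)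
      (sym (≡.cong₂ ℤ._+_ (ℤₚ.*-identityʳ (+ m)) (ℤₚ.*-identityʳ (+ n))))) ⟩
    ℚᵘ.mkℚᵘ (+ m) 0 ℚᵘ.+ ℚᵘ.mkℚᵘ (+ n) 0   ≈⟨ ℚᵘₚ.+-cong (ℚᵘₚ.≃-sym (toℚᵘ-ι m)) (ℚᵘₚ.≃-sym (toℚᵘ-ι n)) ⟩
    toℚᵘ (ι m) ℚᵘ.+ toℚᵘ (ι n)             ≈⟨ ℚᵘₚ.≃-sym (ℚₚ.toℚᵘ-homo-+ (ι m) (ι n)) ⟩
    toℚᵘ (ι m + ι n)                       ∎)
    where open import Relation.Binary.Reasoning.Setoid ℚᵘₚ.≃-setoid

  ι-* : ∀ m n → ι (m ℕ.* n) ≡ ι m * ι n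
  ι-* zero    n = sym (ℚₚ.*-zeroˡ (ι n))
  ι-* (suc m) n = begin
    ι (n ℕ.+ m ℕ.* n)     ≡⟨ ι-+ n (m ℕ.* n) ⟩
    ι n + ι (m ℕ.* n)     ≡⟨ ≡.cong₂ _+_ (sym (ℚₚ.*-identityˡ (ι n))) (ι-* m n) ⟩
    1ℚ * ι n + ι m * ι n  ≡⟨ sym (ℚₚ.*-distribʳ-+ (ι n) 1ℚ (ι m)) ⟩
    (1ℚ + ι m) * ι n      ≡⟨ cong (_* ι n) (sym (ι-+ 1 m)) ⟩
    ι (suc m) * ι n       ∎
    where open ≡.≡-Reasoning

  ι-mono-≤ : ∀ {m n} → m ℕ.≤ n → ι m ≤ ι n
  ι-mono-≤ {m} {n} m≤n = ℚₚ.toℚᵘ-cancel-≤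
    (ℚᵘₚ.≤-respˡ-≃ (ℚᵘₚ.≃-sym (toℚᵘ-ι m)) (ℚᵘₚ.≤-respʳ-≃ (ℚᵘₚ.≃-sym (toℚᵘ-ι n))
      (ℚᵘ.*≤* (ℤₚ.*-monoʳ-≤-nonNeg (+ 1) (ℤ.+≤+ m≤n)))))

  *-nonNeg : ∀ {p q} → 0ℚ ≤ p → 0ℚ ≤ q → 0ℚ ≤ p * q
  *-nonNeg {p} {q} 0≤p 0≤q = ℚₚ.nonNegative⁻¹ (p * q)
    {{ℚₚ.nonNeg*nonNeg⇒nonNeg p {{nonNegative 0≤p}} q {{nonNegative 0≤q}}}}

  p≤q⇒0≤q-p : ∀ {p q} → p ≤ q → 0ℚ ≤ q - p
  p≤q⇒0≤q-p {p} {q} p≤q = subst (_≤ q - p) (ℚₚ.+-inverseʳ p) (ℚₚ.+-monoˡ-≤ (- p) p≤q)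

  0≤q-p⇒p≤q : ∀ {p q} → 0ℚ ≤ q - p → p ≤ q
  0≤q-p⇒p≤q {p} {q} h = ≡.subst₂ _≤_ (ℚₚ.+-identityˡ p) (eq q p) (ℚₚ.+-monoˡ-≤ p h)
    where
    eq : ∀ q p → (q - p) + p ≡ q
    eq = solve 2 (λ q p → (q :- p) :+ p := q) refl

  p≤∣p∣ : ∀ p → p ≤ ∣ p ∣
  p≤∣p∣ p with ℚₚ.≤-total 0ℚ p
  ... | inj₁ 0≤p = ℚₚ.≤-reflexive (sym (ℚₚ.0≤p⇒∣p∣≡p 0≤p))
  ... | inj₂ p≤0 = ℚₚ.≤-trans p≤0 (ℚₚ.0≤∣p∣ p)

  ∣p-q∣≡∣q-p∣ : ∀ p q → ∣ p - q ∣ ≡ ∣ q - p ∣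
  ∣p-q∣≡∣q-p∣ p q = ≡.trans (sym (ℚₚ.∣-p∣≡∣p∣ (p - q))) (cong ∣_∣ (eq p q))
    where
    eq : ∀ p q → - (p - q) ≡ q - p
    eq = solve 2 (λ p q → :- (p :- q) := q :- p) refl

open Rationals public

-- The commutative ring of reals

module RealRing where

  open import Data.Rational.Base hiding (_≃_; _⊔_)
  open ℚ-Solver using (solve; _:+_; _:*_; _:-_; :-_; _:=_)
  open ≡ using (refl; sym; trans; cong; subst)
  open ℚₚ.≤-Reasoning
  open _≃_

  private
    ½ε>0 : ∀ {ε} → 0ℚ < ε → 0ℚ < ½ * ε
    ½ε>0 {ε} ε>0 = ℚₚ.positive⁻¹ (½ * ε) {{ℚₚ.pos*pos⇒pos ½ ε {{positive ε>0}}}}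

    ½ε+½ε : ∀ ε → ½ * ε + ½ * ε ≡ ε
    ½ε+½ε ε = trans (sym (ℚₚ.*-distribʳ-+ ε ½ ½)) (ℚₚ.*-identityˡ ε)

    halves : ∀ {p q r ε} → r ≡ p + q → ∣ p ∣ < ½ * ε → ∣ q ∣ < ½ * ε → ∣ r ∣ < ε
    halves {p} {q} {r} {ε} e hp hq = begin-strict
      ∣ r ∣             ≡⟨ cong ∣_∣ e ⟩
      ∣ p + q ∣         ≤⟨ ℚₚ.∣p+q∣≤∣p∣+∣q∣ p q ⟩
      ∣ p ∣ + ∣ q ∣     <⟨ ℚₚ.+-mono-< hp hq ⟩
      ½ * ε + ½ * ε     ≡⟨ ½ε+½ε ε ⟩
      ε                 ∎

  -- The ring laws hold term by term; only the congruences need an estimate.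
  pointwise : ∀ {x y} → (∀ n → seq x n ≡ seq y n) → x ≃ y
  pointwise {x} {y} h .close ε ε>0 = 0 , λ n _ → subst (λ z → ∣ z ∣ < ε)
    (sym (trans (cong (_- seq y n) (h n)) (ℚₚ.+-inverseʳ (seq y n)))) ε>0

  ≃-refl : ∀ {x} → x ≃ x
  ≃-refl = pointwise λ _ → refl

  ≃-sym : ∀ {x y} → x ≃ y → y ≃ x
  ≃-sym {x} {y} h .close ε ε>0 = let N , p = close h ε ε>0 in
    N , λ n N≤n → subst (_< ε) (∣p-q∣≡∣q-p∣ (seq x n) (seq y n)) (p n N≤n)

  private
    combine : ∀ {x x′ y y′ z z′} → x ≃ x′ → y ≃ y′ →
      (∀ n → seq z n - seq z′ n ≡ (seq x n - seq x′ n) + (seq y n - seq y′ n)) → z ≃ z′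
    combine h k e .close ε ε>0 =
      let N , p = close h (½ * ε) (½ε>0 ε>0)
          M , q = close k (½ * ε) (½ε>0 ε>0)
      in N ℕ.⊔ M , λ n le → halves (e n)
        (p n (ℕₚ.m⊔n≤o⇒m≤o N M le)) (q n (ℕₚ.m⊔n≤o⇒n≤o N M le))

  ≃-trans : ∀ {x y z} → x ≃ y → y ≃ z → x ≃ z
  ≃-trans {x} {y} {z} h k = combine h k λ n → eq (seq x n) (seq y n) (seq z n)
    where
    eq : ∀ a b c → a - c ≡ (a - b) + (b - c)
    eq = solve 3 (λ a b c → a :- c := (a :- b) :+ (b :- c)) refl

  +-cong : ∀ {x x′ y y′} → x ≃ x′ → y ≃ y′ → x +ℝ y ≃ x′ +ℝ y′
  +-cong {x} {x′} {y} {y′} h k =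
    combine h k λ n → eq (seq x n) (seq x′ n) (seq y n) (seq y′ n)
    where
    eq : ∀ a a′ b b′ → (a + b) - (a′ + b′) ≡ (a - a′) + (b - b′)
    eq = solve 4 (λ a a′ b b′ → (a :+ b) :- (a′ :+ b′) := (a :- a′) :+ (b :- b′)) refl

  -‿cong : ∀ {x y} → x ≃ y → -ℝ x ≃ -ℝ y
  -‿cong {x} {y} h .close ε ε>0 = let N , p = close h ε ε>0 in
    N , λ n N≤n → subst (_< ε)
      (trans (∣p-q∣≡∣q-p∣ (seq x n) (seq y n)) (cong ∣_∣ (eq (seq x n) (seq y n)))) (p n N≤n)
    where
    eq : ∀ a b → b - a ≡ (- a) - (- b)
    eq = solve 2 (λ a b → b :- a := (:- a) :- (:- b)) refl

  eventually-bounded : ∀ x → ∃ λ B → 0ℚ < B × ∃ λ N → ∀ n → N ℕ.≤ n → ∣ seq x n ∣ ≤ B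
  eventually-bounded x = let N , p = cauchy x 1ℚ (ℚₚ.positive⁻¹ 1ℚ) in
    1ℚ + ∣ seq x N ∣ , ℚₚ.+-mono-<-≤ (ℚₚ.positive⁻¹ 1ℚ) (ℚₚ.0≤∣p∣ (seq x N)) , N , λ n N≤n → begin
      ∣ seq x n ∣                           ≡⟨ cong ∣_∣ (eq (seq x n) (seq x N)) ⟩
      ∣ (seq x n - seq x N) + seq x N ∣     ≤⟨ ℚₚ.∣p+q∣≤∣p∣+∣q∣ (seq x n - seq x N) (seq x N) ⟩
      ∣ seq x n - seq x N ∣ + ∣ seq x N ∣   ≤⟨ ℚₚ.+-monoˡ-≤ ∣ seq x N ∣ (ℚₚ.<⇒≤ (p n N N≤n ℕₚ.≤-refl)) ⟩
      1ℚ + ∣ seq x N ∣                      ∎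
    where
    eq : ∀ a b → a ≡ (a - b) + b
    eq = solve 2 (λ a b → a := (a :- b) :+ b) refl

  -- On the tail where |x| is at most B, it suffices that the second factors are within ε / B.
  *-congˡ : ∀ x {y y′} → y ≃ y′ → x *ℝ y ≃ x *ℝ y′
  *-congˡ x {y} {y′} h .close ε ε>0 =
    let B , B>0 , K , b = eventually-bounded x
        instance
          B⁺ : Positive B
          B⁺ = positive B>0
          ε⁺ : Positive ε
          ε⁺ = positive ε>0
          B≢0 : NonZero B
          B≢0 = ℚₚ.pos⇒nonZero B
        δ = 1/ B * ε
        N , p = close h δ (ℚₚ.positive⁻¹ δ {{ℚₚ.pos*pos⇒pos (1/ B) {{ℚₚ.1/pos⇒pos B}} ε}})
    in K ℕ.⊔ N , λ n le → let d = seq y n - seq y′ n in begin-strict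
      ∣ seq x n * seq y n - seq x n * seq y′ n ∣
        ≡⟨ cong ∣_∣ (eq (seq x n) (seq y n) (seq y′ n)) ⟩
      ∣ seq x n * d ∣        ≡⟨ ℚₚ.∣p*q∣≡∣p∣*∣q∣ (seq x n) d ⟩
      ∣ seq x n ∣ * ∣ d ∣    ≤⟨ ℚₚ.*-monoʳ-≤-nonNeg ∣ d ∣ {{ℚₚ.∣-∣-nonNeg d}} (b n (ℕₚ.m⊔n≤o⇒m≤o K N le)) ⟩
      B * ∣ d ∣              <⟨ ℚₚ.*-monoʳ-<-pos B (p n (ℕₚ.m⊔n≤o⇒n≤o K N le)) ⟩
      B * (1/ B * ε)         ≡⟨ sym (ℚₚ.*-assoc B (1/ B) ε) ⟩
      B * 1/ B * ε           ≡⟨ cong (_* ε) (ℚₚ.*-inverseʳ B) ⟩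
      1ℚ * ε                 ≡⟨ ℚₚ.*-identityˡ ε ⟩
      ε                      ∎
    where
    eq : ∀ a b c → a * b - a * c ≡ a * (b - c)
    eq = solve 3 (λ a b c → a :* b :- a :* c := a :* (b :- c)) refl

  *-comm : ∀ x y → x *ℝ y ≃ y *ℝ x
  *-comm x y = pointwise λ n → ℚₚ.*-comm (seq x n) (seq y n)

  *-cong : ∀ {x x′ y y′} → x ≃ x′ → y ≃ y′ → x *ℝ y ≃ x′ *ℝ y′
  *-cong {x} {x′} {y} {y′} h k = ≃-trans (*-congˡ x k)
    (≃-trans (*-comm x y′) (≃-trans (*-congˡ y′ h) (*-comm y′ x′)))

  ℝ-commutativeRing : CommutativeRing 0ℓ 0ℓ
  ℝ-commutativeRing = record
    { Carrier = ℝ ; _≈_ = _≃_ ; _+_ = _+ℝ_ ; _*_ = _*ℝ_ ; -_ = -ℝ_ ; 0# = 0ℝ ; 1# = 1ℝ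
    ; isCommutativeRing = record
      { isRing = record
        { +-isAbelianGroup = record
          { isGroup = record
            { isMonoid = record
              { isSemigroup = record
                { isMagma = record
                  { isEquivalence = record { refl = ≃-refl ; sym = ≃-sym ; trans = ≃-trans }
                  ; ∙-cong = +-cong
                  }
                ; assoc = λ x y z → pointwise λ n → ℚₚ.+-assoc (seq x n) (seq y n) (seq z n)
                }
              ; identity = (λ x → pointwise λ n → ℚₚ.+-identityˡ (seq x n))
                         , (λ x → pointwise λ n → ℚₚ.+-identityʳ (seq x n))
              }
            ; inverse = (λ x → pointwise λ n → ℚₚ.+-inverseˡ (seq x n))
                      , (λ x → pointwise λ n → ℚₚ.+-inverseʳ (seq x n))
            ; ⁻¹-cong = -‿cong
            }
          ; comm = λ x y → pointwise λ n → ℚₚ.+-comm (seq x n) (seq y n)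
          }
        ; *-cong = *-cong
        ; *-assoc = λ x y z → pointwise λ n → ℚₚ.*-assoc (seq x n) (seq y n) (seq z n)
        ; *-identity = (λ x → pointwise λ n → ℚₚ.*-identityˡ (seq x n))
                     , (λ x → pointwise λ n → ℚₚ.*-identityʳ (seq x n))
        ; distrib = (λ x y z → pointwise λ n → ℚₚ.*-distribˡ-+ (seq x n) (seq y n) (seq z n))
                  , (λ x y z → pointwise λ n → ℚₚ.*-distribʳ-+ (seq x n) (seq y n) (seq z n))
        }
      ; *-comm = *-comm
      }
    }

  open PolynomialFunctions ℝ-commutativeRing using (nat; NatsInvertible)

  seq-nat : ∀ m n → seq (nat m) n ≡ ι m
  seq-nat zero    n = refl
  seq-nat (suc m) n = trans (cong (1ℚ ℚ.+_) (seq-nat m n)) (sym (ι-+ 1 m))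

  ℝ-natsInvertible : NatsInvertible
  ℝ-natsInvertible m = fromℚ (1/ ι (suc m)) , pointwise λ n →
    trans (cong (1/ ι (suc m) *_) (seq-nat (suc m) n)) (ℚₚ.*-inverseˡ (ι (suc m)))
    where
    instance
      ι≢0 : NonZero (ι (suc m))
      ι≢0 = ℚₚ.pos⇒nonZero (ι (suc m)) {{ℚₚ.normalize-pos (suc m) 1}}

open RealRing public using (ℝ-commutativeRing; ℝ-natsInvertible)

-- Counting closed walks

module Walks {n} (G : Graph n) where

  open import Data.Nat.Base using (_+_; _*_; _^_; _≤_; _<ᵇ_; z≤n)
  open ℕ-Solver using (solve; _:+_; _:*_; _:=_; con)
  open ≡ using (refl; sym; trans; cong; cong₂)
  open Graph G
  open RawMonoidDefs ℕ.+-0-rawMonoid using (sum)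
  open Algebra.Properties.Semiring.Sum ℕₚ.+-*-semiring
    using (sum-cong-≗; ∑-distrib-+; ∑-comm; *-distribˡ-sum; *-distribʳ-sum)

  sum-mono : ∀ {n} {f g : Fin n → ℕ} → (∀ i → f i ≤ g i) → sum f ≤ sum g
  sum-mono {zero}  h = z≤n
  sum-mono {suc n} h = ℕₚ.+-mono-≤ (h zero) (sum-mono (h ∘ suc))

  sum-const : ∀ n {a} → sum {n} (λ _ → a) ≡ n * a
  sum-const zero        = refl
  sum-const (suc n) {a} = cong (a +_) (sum-const n)

  ≤-sum : ∀ {n} (f : Fin n → ℕ) i → f i ≤ sum f
  ≤-sum f zero    = ℕₚ.m≤m+n _ _
  ≤-sum f (suc i) = ℕₚ.≤-trans (≤-sum (f ∘ suc) i) (ℕₚ.m≤n+m _ (f zero))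

  ⟦_⟧ : Bool → ℕ
  ⟦ b ⟧ = if b then 1 else 0

  ∣tabulate∣ : ∀ {n} (f : Fin n → Bool) → Subset.∣ tabulate f ∣ ≡ sum (λ i → ⟦ f i ⟧)
  ∣tabulate∣ {zero}  f = refl
  ∣tabulate∣ {suc n} f with f zero
  ... | true  = cong suc (∣tabulate∣ (f ∘ suc))
  ... | false = ∣tabulate∣ (f ∘ suc)

  δ : ∀ {n} → Fin n → Fin n → ℕ
  δ i j = ⟦ does (i ≟ᶠ j) ⟧

  sum-δ : ∀ {n} (i : Fin n) (f : Fin n → ℕ) → sum (λ j → δ i j * f j) ≡ f i
  sum-δ {suc n} zero    f = trans
    (cong₂ _+_ (ℕₚ.*-identityˡ (f zero)) (trans (sum-const n) (ℕₚ.*-zeroʳ n))) (ℕₚ.+-identityʳ _)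
  sum-δ (suc i) f = sum-δ i (f ∘ suc)

  B : Fin n → Fin n → ℕ
  B i j = ⟦ adj i j ⟧

  -- Follows `pow` clause by clause, the last step being split off, so that `seq-pow` is a direct
  -- induction.
  walks : ℕ → Fin n → Fin n → ℕ
  walks zero    i j = δ i j
  walks (suc m) i j = sum (λ k → walks m i k * B k j)

  closedWalks : ℕ → ℕ
  closedWalks m = sum (λ i → walks m i i)

  d : Fin n → ℕ
  d = degree G

  B-sym : ∀ i j → B i j ≡ B j i
  B-sym i j = cong ⟦_⟧ (symm i j)

  d≡sum : ∀ i → d i ≡ sum (B i)
  d≡sum i = ∣tabulate∣ (adj i)

  walks₁ : ∀ i j → walks 1 i j ≡ B i j
  walks₁ i j = sum-δ i (λ k → B k j)

  walks₂ : ∀ i j → walks 2 i j ≡ sum (λ k → B i k * B k j)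
  walks₂ i j = sum-cong-≗ (λ k → cong (_* B k j) (walks₁ i k))

  walks₂-sym : ∀ i j → walks 2 i j ≡ walks 2 j i
  walks₂-sym i j = trans (walks₂ i j) (trans
    (sum-cong-≗ (λ k → trans (ℕₚ.*-comm (B i k) (B k j)) (cong₂ _*_ (B-sym k j) (B-sym i k))))
    (sym (walks₂ j i)))

  walks₂-diag : ∀ i → walks 2 i i ≡ d i
  walks₂-diag i = trans (walks₂ i i) (trans
    (sum-cong-≗ (λ k → trans (cong (B i k *_) (B-sym k i)) (⟦⟧-idem (adj i k))))
    (sym (d≡sum i)))
    where
    ⟦⟧-idem : ∀ b → ⟦ b ⟧ * ⟦ b ⟧ ≡ ⟦ b ⟧
    ⟦⟧-idem true  = refl
    ⟦⟧-idem false = refl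

  -- A walk that ends at k has `d k` extensions by one step. This yields both ∑ d² for length 2 and
  -- the bound Δ^m.
  walks-row : ∀ m i → sum (walks (suc m) i) ≡ sum (λ k → walks m i k * d k)
  walks-row m i = begin
    sum (λ j → sum (λ k → walks m i k * B k j))   ≡⟨ ∑-comm (λ j k → walks m i k * B k j) ⟩
    sum (λ k → sum (λ j → walks m i k * B k j))   ≡⟨ sum-cong-≗ (λ k → sym (*-distribˡ-sum (walks m i k) (B k))) ⟩
    sum (λ k → walks m i k * sum (B k))           ≡⟨ sum-cong-≗ (λ k → cong (walks m i k *_) (sym (d≡sum k))) ⟩
    sum (λ k → walks m i k * d k)                 ∎
    where open ≡.≡-Reasoning

  sum-walks₂ : sum (λ i → sum (walks 2 i)) ≡ sum (λ k → d k * d k)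
  sum-walks₂ = begin
    sum (λ i → sum (walks 2 i))                   ≡⟨ sum-cong-≗ (walks-row 1) ⟩
    sum (λ i → sum (λ k → walks 1 i k * d k))     ≡⟨ ∑-comm (λ i k → walks 1 i k * d k) ⟩
    sum (λ k → sum (λ i → walks 1 i k * d k))     ≡⟨ sum-cong-≗ (λ k → sym (*-distribʳ-sum (d k) (λ i → walks 1 i k))) ⟩
    sum (λ k → sum (λ i → walks 1 i k) * d k)
      ≡⟨ sum-cong-≗ (λ k → cong (_* d k) (trans
           (sum-cong-≗ (λ i → trans (walks₁ i k) (B-sym i k))) (sym (d≡sum k)))) ⟩
    sum (λ k → d k * d k)                         ∎
    where open ≡.≡-Reasoning

  -- The walk is cut at its midpoint l; by symmetry both halves are counted by `walks 2 i l`.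
  walks₄-diag : ∀ i → walks 4 i i ≡ sum (λ l → walks 2 i l * walks 2 i l)
  walks₄-diag i = begin
    sum (λ k → sum (λ l → w l * B l k) * B k i)
      ≡⟨ sum-cong-≗ (λ k → *-distribʳ-sum (B k i) (λ l → w l * B l k)) ⟩
    sum (λ k → sum (λ l → w l * B l k * B k i))
      ≡⟨ ∑-comm (λ k l → w l * B l k * B k i) ⟩
    sum (λ l → sum (λ k → w l * B l k * B k i))
      ≡⟨ sum-cong-≗ (λ l → trans
           (sum-cong-≗ (λ k → ℕₚ.*-assoc (w l) (B l k) (B k i)))
           (trans (sym (*-distribˡ-sum (w l) (λ k → B l k * B k i)))
             (cong (w l *_) (trans (sym (walks₂ l i)) (walks₂-sym l i))))) ⟩
    sum (λ l → w l * w l) ∎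
    where
    open ≡.≡-Reasoning
    w : Fin n → ℕ
    w = walks 2 i

  closedWalks₂ : closedWalks 2 ≡ sum d
  closedWalks₂ = sum-cong-≗ walks₂-diag

  -- The closed walks of length 4 through i are counted by the squares of
  -- walks 2 i l; off the diagonal a square of a natural is at least its root.
  closedWalks₄ : sum (λ i → d i * d i) + sum (λ i → d i * d i) ≤ closedWalks 4 + sum d
  closedWalks₄ = begin
    sum (λ i → d i * d i) + sum (λ i → d i * d i)
      ≡⟨ cong (_+ sum (λ i → d i * d i)) (sym sum-walks₂) ⟩
    sum (λ i → sum (walks 2 i)) + sum (λ i → d i * d i)
      ≡⟨ sym (∑-distrib-+ (λ i → sum (walks 2 i)) (λ i → d i * d i)) ⟩
    sum (λ i → sum (walks 2 i) + d i * d i)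
      ≤⟨ sum-mono row ⟩
    sum (λ i → walks 4 i i + d i)
      ≡⟨ ∑-distrib-+ (λ i → walks 4 i i) d ⟩
    closedWalks 4 + sum d ∎
    where
    open ℕₚ.≤-Reasoning
    m≤m*m : ∀ m → m ≤ m * m
    m≤m*m zero    = z≤n
    m≤m*m (suc m) = ℕₚ.m≤m+n (suc m) (m * suc m)
    term : ∀ b z → z + ⟦ b ⟧ * (z * z) ≤ z * z + ⟦ b ⟧ * z
    term true  z = ℕₚ.≤-reflexive (solve 1 (λ z → z :+ con 1 :* (z :* z) := z :* z :+ con 1 :* z) refl z)
    term false z = ℕₚ.+-monoˡ-≤ 0 (m≤m*m z)
    row : ∀ i → sum (walks 2 i) + d i * d i ≤ walks 4 i i + d i
    row i = begin
      sum w + d i * d i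
        ≡⟨ cong (λ z → sum w + z * z) (sym (walks₂-diag i)) ⟩
      sum w + w i * w i
        ≡⟨ cong (sum w +_) (sym (sum-δ i (λ l → w l * w l))) ⟩
      sum w + sum (λ l → δ i l * (w l * w l))
        ≡⟨ sym (∑-distrib-+ w (λ l → δ i l * (w l * w l))) ⟩
      sum (λ l → w l + δ i l * (w l * w l))
        ≤⟨ sum-mono (λ l → term (does (i ≟ᶠ l)) (w l)) ⟩
      sum (λ l → w l * w l + δ i l * w l)
        ≡⟨ ∑-distrib-+ (λ l → w l * w l) (λ l → δ i l * w l) ⟩
      sum (λ l → w l * w l) + sum (λ l → δ i l * w l)
        ≡⟨ cong₂ _+_ (sym (walks₄-diag i)) (trans (sum-δ i w) (walks₂-diag i)) ⟩
      walks 4 i i + d i ∎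
      where
      w : Fin n → ℕ
      w = walks 2 i

  -- Ordered adjacent pairs are split by which endpoint is smaller; exchanging the sums shows that
  -- both kinds number `edgeCount G`.
  handshake : sum d ≡ 2 * edgeCount G
  handshake = begin
    sum d
      ≡⟨ sum-cong-≗ d≡sum ⟩
    sum (λ i → sum (B i))
      ≡⟨ sum-cong-≗ (λ i → trans (sum-cong-≗ (split i)) (∑-distrib-+ (up i) (λ j → up j i))) ⟩
    sum (λ i → sum (up i) + sum (λ j → up j i))
      ≡⟨ ∑-distrib-+ (λ i → sum (up i)) (λ i → sum (λ j → up j i)) ⟩
    sum (λ i → sum (up i)) + sum (λ i → sum (λ j → up j i))
      ≡⟨ cong (sum (λ i → sum (up i)) +_) (∑-comm (λ i j → up j i)) ⟩
    sum (λ i → sum (up i)) + sum (λ i → sum (up i))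
      ≡⟨ cong₂ _+_ e (trans e (sym (ℕₚ.+-identityʳ _))) ⟩
    2 * edgeCount G ∎
    where
    open ≡.≡-Reasoning
    up : Fin n → Fin n → ℕ
    up i j = ⟦ (toℕ i <ᵇ toℕ j) ∧ adj i j ⟧
    e : sum (λ i → sum (up i)) ≡ edgeCount G
    e = sym (sum-cong-≗ (λ i → ∣tabulate∣ (λ j → (toℕ i <ᵇ toℕ j) ∧ adj i j)))
    <ᵇ-true : ∀ {a b} → a ℕ.< b → (a <ᵇ b) ≡ true
    <ᵇ-true a<b = Equivalence.to T-≡ (ℕₚ.<⇒<ᵇ a<b)
    <ᵇ-false : ∀ {a b} → b ≤ a → (a <ᵇ b) ≡ false
    <ᵇ-false {a} {b} b≤a = ¬-not λ eq → ℕₚ.≤⇒≯ b≤a (ℕₚ.<ᵇ⇒< a b (Equivalence.from T-≡ eq))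
    split : ∀ i j → B i j ≡ up i j + up j i
    split i j with ℕₚ.<-cmp (toℕ i) (toℕ j)
    ... | tri< i<j _ _ rewrite <ᵇ-true i<j | <ᵇ-false (ℕₚ.<⇒≤ i<j) = sym (ℕₚ.+-identityʳ _)
    ... | tri> _ _ j<i rewrite <ᵇ-true j<i | <ᵇ-false (ℕₚ.<⇒≤ j<i) = B-sym i j
    ... | tri≈ _ i≡j _ with ≡.refl ← toℕ-injective i≡j
      rewrite <ᵇ-false (ℕₚ.≤-refl {toℕ i}) = cong ⟦_⟧ (irrefl i)

  d≤max : ∀ i → d i ≤ maxDegree G
  d≤max = go d
    where
    go : ∀ {n} (f : Fin n → ℕ) i → f i ≤ Vector.foldr ℕ._⊔_ 0 f
    go f zero    = ℕₚ.m≤m⊔n (f zero) _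
    go f (suc i) = ℕₚ.≤-trans (go (f ∘ suc) i) (ℕₚ.m≤n⊔m (f zero) _)

  -- Closed walks are bounded by all walks from the same vertex. The factor n fades from the bound
  -- on a single eigenvalue only as m grows.
  closedWalks≤ : ∀ {Δ} → maxDegree G ≤ Δ → ∀ m → closedWalks m ≤ n * Δ ^ m
  closedWalks≤ {Δ} max≤Δ m = ℕₚ.≤-trans
    (sum-mono (λ i → ℕₚ.≤-trans (≤-sum (walks m i) i) (row m i)))
    (ℕₚ.≤-reflexive (sum-const n))
    where
    open ℕₚ.≤-Reasoning
    row : ∀ m i → sum (walks m i) ≤ Δ ^ m
    row zero i = ℕₚ.≤-reflexive (trans
      (sum-cong-≗ (λ j → sym (ℕₚ.*-identityʳ (δ i j)))) (sum-δ i (λ _ → 1)))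
    row (suc m) i = begin
      sum (walks (suc m) i)             ≡⟨ walks-row m i ⟩
      sum (λ k → walks m i k * d k)     ≤⟨ sum-mono (λ k → ℕₚ.*-monoʳ-≤ (walks m i k) (ℕₚ.≤-trans (d≤max k) max≤Δ)) ⟩
      sum (λ k → walks m i k * Δ)       ≡⟨ sym (*-distribʳ-sum Δ (walks m i)) ⟩
      sum (walks m i) * Δ               ≤⟨ ℕₚ.*-monoˡ-≤ Δ (row m i) ⟩
      Δ ^ m * Δ                         ≡⟨ ℕₚ.*-comm (Δ ^ m) Δ ⟩
      Δ ^ suc m                         ∎

  -- (x − 3)(x − 4) ≥ 0 for every natural x
  7*≤²+12 : ∀ x → 7 * x ≤ x * x + 12
  7*≤²+12 0 = z≤n
  7*≤²+12 1 = ℕₚ.m≤m+n 7 6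
  7*≤²+12 2 = ℕₚ.m≤m+n 14 2
  7*≤²+12 3 = ℕₚ.≤-refl
  7*≤²+12 (suc (suc (suc (suc e)))) = ℕₚ.≤-trans (ℕₚ.m≤m+n _ (e + e * e))
    (ℕₚ.≤-reflexive (solve 1 (λ e → con 7 :* (con 4 :+ e) :+ (e :+ e :* e)
      := (con 4 :+ e) :* (con 4 :+ e) :+ con 12) refl e))

  -- `squares` taken twice gives 14 ∑ d ≤ 2 ∑ d² + 24 n; `closedWalks₄` bounds 2 ∑ d², and one ∑ d
  -- cancels. Degrees 3 and 4 give equality in `squares`, and with 2n - 1 edges the mean degree 4 -
  -- 2/n lies between them.
  closedWalks₄≥ : 13 * sum d ≤ closedWalks 4 + 24 * n
  closedWalks₄≥ = ℕₚ.+-cancelˡ-≤ (sum d) _ _ (begin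
    sum d + 13 * sum d
      ≡⟨ solve 1 (λ s → s :+ con 13 :* s := con 7 :* s :+ con 7 :* s) refl (sum d) ⟩
    7 * sum d + 7 * sum d
      ≤⟨ ℕₚ.+-mono-≤ squares squares ⟩
    (S + n * 12) + (S + n * 12)
      ≡⟨ solve 2 (λ S n → (S :+ n :* con 12) :+ (S :+ n :* con 12) := (S :+ S) :+ con 24 :* n) refl S n ⟩
    (S + S) + 24 * n
      ≤⟨ ℕₚ.+-monoˡ-≤ (24 * n) closedWalks₄ ⟩
    (closedWalks 4 + sum d) + 24 * n
      ≡⟨ solve 3 (λ w s t → (w :+ s) :+ t := s :+ (w :+ t)) refl (closedWalks 4) (sum d) (24 * n) ⟩
    sum d + (closedWalks 4 + 24 * n) ∎)
    where
    open ℕₚ.≤-Reasoning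
    S = sum (λ i → d i * d i)
    squares : 7 * sum d ≤ S + n * 12
    squares = begin
      7 * sum d                      ≡⟨ *-distribˡ-sum 7 d ⟩
      sum (λ i → 7 * d i)            ≤⟨ sum-mono (λ i → 7*≤²+12 (d i)) ⟩
      sum (λ i → d i * d i + 12)     ≡⟨ ∑-distrib-+ (λ i → d i * d i) (λ _ → 12) ⟩
      S + sum {n} (λ _ → 12)         ≡⟨ cong (S +_) (sum-const n) ⟩
      S + n * 12                     ∎

open RawMonoidDefs ℚ.+-0-rawMonoid using () renaming (sum to sumℚ)

-- Rational inequalities behind the energy bound

module RationalSums where

  open import Data.Integer.Base using (+_)
  open import Data.Rational.Base
  open ≡ using (refl; sym; trans; cong; cong₂; subst)
  open ℚ-Solver using (solve; _:+_; _:*_; _:-_; :-_; _:=_; con)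
  open RawSemiringDefs ℚ.+-*-rawSemiring using (_^_)
  open ℚₚ.≤-Reasoning

  ≤-sumℚ : ∀ {n} (f : Fin n → ℚ) → (∀ i → 0ℚ ≤ f i) → ∀ i → f i ≤ sumℚ f
  sumℚ-nonNeg : ∀ {n} (f : Fin n → ℚ) → (∀ i → 0ℚ ≤ f i) → 0ℚ ≤ sumℚ f
  sumℚ-nonNeg {zero}  f h = ℚₚ.≤-refl
  sumℚ-nonNeg {suc n} f h = ℚₚ.+-mono-≤ (h zero) (sumℚ-nonNeg (f ∘ suc) (h ∘ suc))
  ≤-sumℚ f h zero = begin
    f zero          ≡⟨ sym (ℚₚ.+-identityʳ (f zero)) ⟩
    f zero + 0ℚ     ≤⟨ ℚₚ.+-monoʳ-≤ (f zero) (sumℚ-nonNeg (f ∘ suc) (h ∘ suc)) ⟩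
    sumℚ f          ∎
  ≤-sumℚ f h (suc i) = begin
    f (suc i)               ≤⟨ ≤-sumℚ (f ∘ suc) (h ∘ suc) i ⟩
    sumℚ (f ∘ suc)          ≡⟨ sym (ℚₚ.+-identityˡ _) ⟩
    0ℚ + sumℚ (f ∘ suc)     ≤⟨ ℚₚ.+-monoˡ-≤ (sumℚ (f ∘ suc)) (h zero) ⟩
    sumℚ f                  ∎

  sumℚ-≤ : ∀ {n} a b c d (t f g : Fin n → ℚ) →
    (∀ i → a * t i ≤ b + c * f i - d * g i) →
    a * sumℚ t ≤ b * ι n + c * sumℚ f - d * sumℚ g
  sumℚ-≤ {zero} a b c d t f g h = ℚₚ.≤-reflexive (eq a b c d)
    where
    eq : ∀ a b c d → a * 0ℚ ≡ b * 0ℚ + c * 0ℚ - d * 0ℚ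
    eq = solve 4 (λ a b c d → a :* con 0ℚ := b :* con 0ℚ :+ c :* con 0ℚ :- d :* con 0ℚ) refl
  sumℚ-≤ {suc n} a b c d t f g h = begin
    a * (t zero + T)
      ≡⟨ ℚₚ.*-distribˡ-+ a (t zero) T ⟩
    a * t zero + a * T
      ≤⟨ ℚₚ.+-mono-≤ (h zero) (sumℚ-≤ a b c d (t ∘ suc) (f ∘ suc) (g ∘ suc) (h ∘ suc)) ⟩
    (b + c * f zero - d * g zero) + (b * ι n + c * F - d * G)
      ≡⟨ eq b c d (f zero) (g zero) (ι n) F G ⟩
    b * (1ℚ + ι n) + c * (f zero + F) - d * (g zero + G)
      ≡⟨ cong (λ z → b * z + c * (f zero + F) - d * (g zero + G)) (sym (ι-+ 1 n)) ⟩
    b * ι (suc n) + c * (f zero + F) - d * (g zero + G) ∎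
    where
    T = sumℚ (t ∘ suc)
    F = sumℚ (f ∘ suc)
    G = sumℚ (g ∘ suc)
    eq : ∀ b c d f g N F G → (b + c * f - d * g) + (b * N + c * F - d * G)
      ≡ b * (1ℚ + N) + c * (f + F) - d * (g + G)
    eq = solve 8 (λ b c d f g N F G → (b :+ c :* f :- d :* g) :+ (b :* N :+ c :* F :- d :* G)
      := b :* (con 1ℚ :+ N) :+ c :* (f :+ F) :- d :* (g :+ G)) refl

  ∣p∣*∣p∣ : ∀ p → ∣ p ∣ * ∣ p ∣ ≡ p * p
  ∣p∣*∣p∣ p with ℚₚ.∣p∣≡p∨∣p∣≡-p p
  ... | inj₁ e = cong₂ _*_ e e
  ... | inj₂ e = trans (cong₂ _*_ e e) (eq p)
    where
    eq : ∀ p → - p * - p ≡ p * p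
    eq = solve 1 (λ p → :- p :* :- p := p :* p) refl

  square-nonNeg : ∀ p → 0ℚ ≤ p * p
  square-nonNeg p = subst (0ℚ ≤_) (∣p∣*∣p∣ p) (*-nonNeg (ℚₚ.0≤∣p∣ p) (ℚₚ.0≤∣p∣ p))

  even-power-nonNeg : ∀ m p → 0ℚ ≤ p ^ (m ℕ.+ m)
  even-power-nonNeg m p = subst (0ℚ ≤_) (sym (^-homo-* p m m)) (square-nonNeg (p ^ m))
    where open Algebra.Properties.Semiring.Exp (CommutativeRing.semiring ℚₚ.+-*-commutativeRing)
            using (^-homo-*)

  ∣p^m∣ : ∀ m p → ∣ p ^ m ∣ ≡ ∣ p ∣ ^ m
  ∣p^m∣ zero    p = refl
  ∣p^m∣ (suc m) p = trans (ℚₚ.∣p*q∣≡∣p∣*∣q∣ p (p ^ m)) (cong (∣ p ∣ *_) (∣p^m∣ m p))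

  ^-mono : ∀ m {p q} → 0ℚ ≤ p → p ≤ q → p ^ m ≤ q ^ m
  ^-nonNeg : ∀ m {p} → 0ℚ ≤ p → 0ℚ ≤ p ^ m
  ^-nonNeg zero    h = ℚₚ.nonNegative⁻¹ 1ℚ
  ^-nonNeg (suc m) h = *-nonNeg h (^-nonNeg m h)
  ^-mono zero    h p≤q = ℚₚ.≤-refl
  ^-mono (suc m) {p} {q} h p≤q = begin
    p * p ^ m   ≤⟨ ℚₚ.*-monoʳ-≤-nonNeg (p ^ m) {{nonNegative (^-nonNeg m h)}} p≤q ⟩
    q * p ^ m   ≤⟨ ℚₚ.*-monoˡ-≤-nonNeg q {{nonNegative (ℚₚ.≤-trans h p≤q)}} (^-mono m h p≤q) ⟩
    q * q ^ m   ∎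

  -- Strictness of the hypothesis lets monotonicity of powers refute b < |p|; the exponent m + m
  -- makes the power of p equal to that of |p|.
  ∣p∣≤-from-power : ∀ m {p b} → 0ℚ ≤ b → p ^ (m ℕ.+ m) < b ^ (m ℕ.+ m) → ∣ p ∣ ≤ b
  ∣p∣≤-from-power m {p} {b} 0≤b h = ℚₚ.≮⇒≥ λ b<∣p∣ → ℚₚ.<-irrefl refl (ℚₚ.<-≤-trans h (begin
    b ^ (m ℕ.+ m)       ≤⟨ ^-mono (m ℕ.+ m) 0≤b (ℚₚ.<⇒≤ b<∣p∣) ⟩
    ∣ p ∣ ^ (m ℕ.+ m)   ≡⟨ sym (∣p^m∣ (m ℕ.+ m) p) ⟩
    ∣ p ^ (m ℕ.+ m) ∣   ≡⟨ ℚₚ.0≤p⇒∣p∣≡p (even-power-nonNeg m p) ⟩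
    p ^ (m ℕ.+ m)       ∎))

  -- The quartic a + b t² − c t⁴ that touches t at 7/4 and meets it at 21/5,
  -- scaled to integers; 7/4 is close to optimal for the resulting energy bound.
  quartic-bound : ∀ p → ∣ p ∣ ≤ + 21 / 5 →
    ι 99127 * ∣ p ∣ ≤ ι 79233 + ι 33222 * p ^ 2 - ι 800 * p ^ 4
  quartic-bound p h = begin
    ι 99127 * t
      ≡⟨ sym (ℚₚ.+-identityʳ _) ⟩
    ι 99127 * t + 0ℚ
      -- The added product is the difference of the two sides. Its fourth root -77/10 is forced:
      -- without a cubic term the roots 7/4, 7/4, 21/5 and the last one sum to zero.
      ≤⟨ ℚₚ.+-monoʳ-≤ (ι 99127 * t) 
           (*-nonNeg (*-nonNeg (square-nonNeg (ι 4 * t - ι 7)) (p≤q⇒0≤q-p 5t≤21)) 0≤10t+77) ⟩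
    ι 99127 * t + (ι 4 * t - ι 7) * (ι 4 * t - ι 7) * (ι 21 - ι 5 * t) * (ι 10 * t + ι 77)
      ≡⟨ eq t ⟩
    ι 79233 + ι 33222 * (t * t) - ι 800 * ((t * t) * (t * t))
      ≡⟨ cong (λ z → ι 79233 + ι 33222 * z - ι 800 * (z * z)) (∣p∣*∣p∣ p) ⟩
    ι 79233 + ι 33222 * (p * p) - ι 800 * ((p * p) * (p * p))
      ≡⟨ eq′ p (ι 79233) (ι 33222) (ι 800) ⟩
    ι 79233 + ι 33222 * p ^ 2 - ι 800 * p ^ 4 ∎
    where
    t = ∣ p ∣
    5t≤21 : ι 5 * t ≤ ι 21
    5t≤21 = ℚₚ.*-monoˡ-≤-nonNeg (ι 5) h
    0≤10t+77 : 0ℚ ≤ ι 10 * t + ι 77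
    0≤10t+77 = ℚₚ.+-mono-≤ (*-nonNeg (ℚₚ.nonNegative⁻¹ (ι 10)) (ℚₚ.0≤∣p∣ p)) (ℚₚ.nonNegative⁻¹ (ι 77))
    eq : ∀ t → ι 99127 * t + (ι 4 * t - ι 7) * (ι 4 * t - ι 7) * (ι 21 - ι 5 * t) * (ι 10 * t + ι 77)
      ≡ ι 79233 + ι 33222 * (t * t) - ι 800 * ((t * t) * (t * t))
    eq = solve 1 (λ t → con (ι 99127) :* t :+ (con (ι 4) :* t :- con (ι 7)) :* (con (ι 4) :* t :- con (ι 7))
        :* (con (ι 21) :- con (ι 5) :* t) :* (con (ι 10) :* t :+ con (ι 77))
      := con (ι 79233) :+ con (ι 33222) :* (t :* t) :- con (ι 800) :* ((t :* t) :* (t :* t))) refl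
    eq′ : ∀ p a b c → a + b * (p * p) - c * ((p * p) * (p * p)) ≡ a + b * p ^ 2 - c * p ^ 4
    eq′ = solve 4 (λ p a b c → a :+ b :* (p :* p) :- c :* ((p :* p) :* (p :* p))
      := a :+ b :* (p :* (p :* con 1ℚ)) :- c :* (p :* (p :* (p :* (p :* con 1ℚ))))) refl

  -- One tolerance for the approximations of X₂, X₄ and E and for the final gap. At N = 20 the
  -- scaled inequality has slack 18050, and these four uses cost 232276 η, so 1/20 is small enough.
  η : ℚ
  η = + 1 / 20

  -- `S₂` and `S₄` stand for exact walk counts, `X₂`, `X₄` and `T` for sums over approximants of the
  -- eigenvalues, `E` for an approximant of the energy.
  energy-estimate : ∀ {N S₂ S₄ X₂ X₄ T E} → ι 20 ≤ N →
    ι 99127 * T ≤ ι 79233 * N + ι 33222 * X₂ - ι 800 * X₄ →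
    S₂ + ι 2 ≡ ι 4 * N → ι 13 * S₂ ≤ S₄ + ι 24 * N →
    X₂ ≤ S₂ + η → S₄ ≤ X₄ + η → E ≤ T + η →
    E + η ≤ ι 2 * N - ι 2
  energy-estimate {N} {S₂} {S₄} {X₂} {X₄} {T} {E} h₆ h₁ e h₄ h₂ h₃ h₅ =
    0≤q-p⇒p≤q (ℚₚ.*-cancelˡ-≤-pos (ι 99127) (begin
      ι 99127 * 0ℚ ≡⟨ ℚₚ.*-zeroʳ (ι 99127) ⟩
      -- A nonnegative combination of the hypotheses: the multipliers 33222, 800, 800 and 99127
      -- eliminate X₂, X₄, S₄ and T, 8533 is the coefficient of N that remains, and 32181/5 is 18050
      -- - 232276 η.
      0ℚ ≤⟨ add (add (add (add (add (add (p≤q⇒0≤q-p h₁)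
              (scale 33222 (p≤q⇒0≤q-p h₂))) (scale 800 (p≤q⇒0≤q-p h₃))) (scale 800 (p≤q⇒0≤q-p h₄)))
              (scale 99127 (p≤q⇒0≤q-p h₅))) (scale 8533 (p≤q⇒0≤q-p h₆))) (ℚₚ.nonNegative⁻¹ (+ 32181 / 5)) ⟩
      _ ≡⟨ cong (λ S → (ι 79233 * N + ι 33222 * X₂ - ι 800 * X₄ - ι 99127 * T)
             + ι 33222 * ((S + η) - X₂) + ι 800 * ((X₄ + η) - S₄)
             + ι 800 * ((S₄ + ι 24 * N) - ι 13 * S) + ι 99127 * ((T + η) - E)
             + ι 8533 * (N - ι 20) + + 32181 / 5) S₂≡ ⟩
      _ ≡⟨ eq N S₄ X₂ X₄ T E ⟩
      ι 99127 * ((ι 2 * N - ι 2) - (E + η)) ∎))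
    where
    add : ∀ {p q} → 0ℚ ≤ p → 0ℚ ≤ q → 0ℚ ≤ p + q
    add = ℚₚ.+-mono-≤
    scale : ∀ k {p} → 0ℚ ≤ p → 0ℚ ≤ ι k * p
    scale k h = *-nonNeg (ι-mono-≤ {0} {k} ℕ.z≤n) h
    S₂≡ : S₂ ≡ ι 4 * N - ι 2
    S₂≡ = trans (cancel S₂ (ι 2)) (cong (_- ι 2) e)
      where
      cancel : ∀ a b → a ≡ (a + b) - b
      cancel = solve 2 (λ a b → a := (a :+ b) :- b) refl
    eq : ∀ N S₄ X₂ X₄ T E → (ι 79233 * N + ι 33222 * X₂ - ι 800 * X₄ - ι 99127 * T)
             + ι 33222 * (((ι 4 * N - ι 2) + η) - X₂) + ι 800 * ((X₄ + η) - S₄)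
             + ι 800 * ((S₄ + ι 24 * N) - ι 13 * (ι 4 * N - ι 2)) + ι 99127 * ((T + η) - E)
             + ι 8533 * (N - ι 20) + + 32181 / 5
      ≡ ι 99127 * ((ι 2 * N - ι 2) - (E + η))
    eq = solve 6 (λ N S₄ X₂ X₄ T E →
      (con (ι 79233) :* N :+ con (ι 33222) :* X₂ :- con (ι 800) :* X₄ :- con (ι 99127) :* T)
        :+ con (ι 33222) :* (((con (ι 4) :* N :- con (ι 2)) :+ con η) :- X₂)
        :+ con (ι 800) :* ((X₄ :+ con η) :- S₄)
        :+ con (ι 800) :* ((S₄ :+ con (ι 24) :* N) :- con (ι 13) :* (con (ι 4) :* N :- con (ι 2)))
        :+ con (ι 99127) :* ((T :+ con η) :- E)
        :+ con (ι 8533) :* (N :- con (ι 20)) :+ con (+ 32181 / 5)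
      := con (ι 99127) :* ((con (ι 2) :* N :- con (ι 2)) :- (E :+ con η))) refl

open RationalSums public

open ≡ using (refl; sym; trans; cong; cong₂; subst)
open import Data.Integer.Base using (+_)
open import Data.Nat.Base using (_*_; _∸_; _≤_)

-- From reals to rational approximants

module SeqHomomorphism where

  open RawSemiringDefs ℚ.+-*-rawSemiring using (_^_)
  open RawSemiringDefs (RawRing.rawSemiring ℝ-rawRing) using () renaming (_^_ to _^ℝ_)
  open Matrices ℝ-rawRing using () renaming (sum to sumℝ)
  open RawMonoidDefs ℕ.+-0-rawMonoid using () renaming (sum to sumℕ)

  seq-sum : ∀ {n} (f : Vector ℝ n) k → seq (sumℝ f) k ≡ sumℚ (λ i → seq (f i) k)
  seq-sum {zero}  f k = refl
  seq-sum {suc n} f k = cong (seq (f zero) k ℚ.+_) (seq-sum (f ∘ suc) k)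

  seq-^ : ∀ x m k → seq (x ^ℝ m) k ≡ seq x k ^ m
  seq-^ x zero    k = refl
  seq-^ x (suc m) k = cong (seq x k ℚ.*_) (seq-^ x m k)

  sumℚ-cong : ∀ {n} {f g : Fin n → ℚ} → (∀ i → f i ≡ g i) → sumℚ f ≡ sumℚ g
  sumℚ-cong {zero}  h = refl
  sumℚ-cong {suc n} h = cong₂ ℚ._+_ (h zero) (sumℚ-cong (h ∘ suc))

  ι-sum : ∀ {n} (f : Fin n → ℕ) → ι (sumℕ f) ≡ sumℚ (ι ∘ f)
  ι-sum {zero}  f = refl
  ι-sum {suc n} f = trans (ι-+ (f zero) (sumℕ (f ∘ suc))) (cong (ι (f zero) ℚ.+_) (ι-sum (f ∘ suc)))

open SeqHomomorphism

module _ {n} (G : Graph n) where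

  open Walks G
  open CharacteristicPolynomials ℝ-commutativeRing using (pow; trace)

  -- The entries are constant sequences, so traces of powers are exact integers at every index; only
  -- the eigenvalue side has to converge.
  seq-pow : ∀ m i j k → seq (pow (adjacencyMatrix G) m i j) k ≡ ι (walks m i j)
  seq-pow zero i j k with does (i ≟ᶠ j)
  ... | true  = refl
  ... | false = refl
  seq-pow (suc m) i j k = trans
    (seq-sum (λ l → pow (adjacencyMatrix G) m i l *ℝ adjacencyMatrix G l j) k)
    (trans (sumℚ-cong (λ l → trans (cong₂ ℚ._*_ (seq-pow m i l k) (entry l))
      (sym (ι-* (walks m i l) (B l j))))) (sym (ι-sum (λ l → walks m i l ℕ.* B l j))))
    where
    entry : ∀ l → seq (adjacencyMatrix G l j) k ≡ ι (B l j)
    entry l with Graph.adj G l j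
    ... | true  = refl
    ... | false = refl

  seq-trace-pow : ∀ m k → seq (trace (pow (adjacencyMatrix G) m)) k ≡ ι (closedWalks m)
  seq-trace-pow m k = trans (seq-sum (λ i → pow (adjacencyMatrix G) m i i) k)
    (trans (sumℚ-cong (λ i → seq-pow m i i k)) (sym (ι-sum (λ i → walks m i i))))

module _ {n} (G : Graph (suc n)) (μ : Vector ℝ (suc n))
  (spectrum : Matrices.IsSpectrum ℝ-rawRing (adjacencyMatrix G) μ) where

  open Walks G using (closedWalks)
  open RawSemiringDefs ℚ.+-*-rawSemiring using (_^_)
  open RawSemiringDefs (RawRing.rawSemiring ℝ-rawRing) using () renaming (_^_ to _^ℝ_)
  open CharacteristicPolynomials ℝ-commutativeRing using (spectrum⇒trace)

  powerSum : ℕ → ℕ → ℚ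
  powerSum m k = sumℚ (λ i → seq (μ i) k ^ m)

  -- The trace identity read through the definition of `_≃_`: power sums of the approximants
  -- converge to an integer.
  powerSum→closedWalks : ∀ m ε → 0ℚ ℚ.< ε →
    ∃ λ N → ∀ k → N ≤ k → ℚ.∣ ι (closedWalks m) ℚ.- powerSum m k ∣ ℚ.< ε
  powerSum→closedWalks m ε ε>0 =
    let N , p = _≃_.close (spectrum⇒trace ℝ-natsInvertible (adjacencyMatrix G) μ spectrum m) ε ε>0
    in N , λ k N≤k → subst (λ z → ℚ.∣ z ∣ ℚ.< ε)
      (cong₂ ℚ._-_ (seq-trace-pow G m k)
        (trans (seq-sum (λ i → μ i ^ℝ m) k) (sumℚ-cong (λ i → seq-^ (μ i) m k))))
      (p k N≤k)

-- The energy bound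

open RawSemiringDefs ℚ.+-*-rawSemiring using (_^_)

private
  ∣p-q∣<ε⇒p≤q+ε : ∀ p q {ε} → ℚ.∣ p ℚ.- q ∣ ℚ.< ε → p ℚ.≤ q ℚ.+ ε
  ∣p-q∣<ε⇒p≤q+ε p q {ε} h = begin
    p                      ≡⟨ eq p q ⟩
    q ℚ.+ (p ℚ.- q)        ≤⟨ ℚₚ.+-monoʳ-≤ q (ℚₚ.≤-trans (p≤∣p∣ (p ℚ.- q)) (ℚₚ.<⇒≤ h)) ⟩
    q ℚ.+ ε                ∎
    where
    open ℚₚ.≤-Reasoning
    open ℚ-Solver
    eq : ∀ p q → p ≡ q ℚ.+ (p ℚ.- q)
    eq = solve 2 (λ p q → p := q :+ (p :- q)) refl

  ∣p-q∣<ε⇒q≤p+ε : ∀ p q {ε} → ℚ.∣ p ℚ.- q ∣ ℚ.< ε → q ℚ.≤ p ℚ.+ ε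
  ∣p-q∣<ε⇒q≤p+ε p q {ε} h = ∣p-q∣<ε⇒p≤q+ε q p (subst (ℚ._< ε) (∣p-q∣≡∣q-p∣ p q) h)

module _ {n m s₂ s₄ s : ℕ} (x : Fin (suc n) → ℚ) (e : ℚ) where

  open ℚₚ.≤-Reasoning

  -- Concerns a single index: `x` holds approximants of the eigenvalues and `e` one of the energy.
  -- The count `s` of closed walks of length m + m serves to bound each |x i| by 21/5.
  approximate-energy : 20 ≤ suc n →
    s₂ ℕ.+ 2 ≡ 4 * suc n → 13 * s₂ ≤ s₄ ℕ.+ 24 * suc n →
    s ≤ suc n * 4 ℕ.^ (m ℕ.+ m) → ι (suc n * 4 ℕ.^ (m ℕ.+ m) ℕ.+ 1) ℚ.< (+ 21 ℚ./ 5) ^ (m ℕ.+ m) →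
    ℚ.∣ ι s₂ ℚ.- sumℚ (λ i → x i ^ 2) ∣ ℚ.< η →
    ℚ.∣ ι s₄ ℚ.- sumℚ (λ i → x i ^ 4) ∣ ℚ.< η →
    ℚ.∣ ι s ℚ.- sumℚ (λ i → x i ^ (m ℕ.+ m)) ∣ ℚ.< 1ℚ →
    ℚ.∣ e ℚ.- sumℚ (λ i → ℚ.∣ x i ∣) ∣ ℚ.< η →
    e ℚ.+ η ℚ.≤ ι (2 * n)
  approximate-energy 20≤n s₂+2 s₄≥ s≤ large h₂ h₄ h hₑ =
    subst (e ℚ.+ η ℚ.≤_) target (energy-estimate {ι (suc n)} {ι s₂} {ι s₄} {X₂} {X₄} {T} {e}
      (ι-mono-≤ 20≤n)
      (sumℚ-≤ (ι 99127) (ι 79233) (ι 33222) (ι 800)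
        (λ i → ℚ.∣ x i ∣) (λ i → x i ^ 2) (λ i → x i ^ 4)
        (λ i → quartic-bound (x i) (∣p∣≤-from-power m (ℚₚ.nonNegative⁻¹ (+ 21 ℚ./ 5)) (x^2m< i))))
      (trans (sym (ι-+ s₂ 2)) (trans (cong ι s₂+2) (ι-* 4 (suc n))))
      S₄≥
      (∣p-q∣<ε⇒q≤p+ε (ι s₂) X₂ h₂) (∣p-q∣<ε⇒p≤q+ε (ι s₄) X₄ h₄) (∣p-q∣<ε⇒p≤q+ε e T hₑ))
    where
    X₂ X₄ T : ℚ
    X₂ = sumℚ (λ i → x i ^ 2)
    X₄ = sumℚ (λ i → x i ^ 4)
    T  = sumℚ (λ i → ℚ.∣ x i ∣)
    target : ι 2 ℚ.* ι (suc n) ℚ.- ι 2 ≡ ι (2 * n)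
    target = trans
      (cong (ℚ._- ι 2) (trans (sym (ι-* 2 (suc n))) (trans (cong ι (ℕₚ.*-suc 2 n)) (ι-+ 2 (2 * n)))))
      (cancel (ι 2) (ι (2 * n)))
      where
      open ℚ-Solver
      cancel : ∀ a b → (a ℚ.+ b) ℚ.- a ≡ b
      cancel = solve 2 (λ a b → (a :+ b) :- a := b) refl
    S₄≥ : ι 13 ℚ.* ι s₂ ℚ.≤ ι s₄ ℚ.+ ι 24 ℚ.* ι (suc n)
    S₄≥ = begin
      ι 13 ℚ.* ι s₂                    ≡⟨ sym (ι-* 13 s₂) ⟩
      ι (13 * s₂)                      ≤⟨ ι-mono-≤ s₄≥ ⟩
      ι (s₄ ℕ.+ 24 * suc n)            ≡⟨ ι-+ s₄ (24 * suc n) ⟩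
      ι s₄ ℚ.+ ι (24 * suc n)          ≡⟨ cong (ι s₄ ℚ.+_) (ι-* 24 (suc n)) ⟩
      ι s₄ ℚ.+ ι 24 ℚ.* ι (suc n)      ∎
    x^2m< : ∀ i → x i ^ (m ℕ.+ m) ℚ.< (+ 21 ℚ./ 5) ^ (m ℕ.+ m)
    x^2m< i = begin-strict
      x i ^ (m ℕ.+ m)
        ≤⟨ ≤-sumℚ (λ i → x i ^ (m ℕ.+ m)) (λ i → even-power-nonNeg m (x i)) i ⟩
      sumℚ (λ i → x i ^ (m ℕ.+ m))                 ≤⟨ ∣p-q∣<ε⇒q≤p+ε (ι s) (sumℚ (λ i → x i ^ (m ℕ.+ m))) h ⟩
      -- The tolerance 1 granted to this power sum is the summand 1 in `large`.
      ι s ℚ.+ ι 1                                  ≡⟨ sym (ι-+ s 1) ⟩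
      ι (s ℕ.+ 1)                                  ≤⟨ ι-mono-≤ (ℕₚ.+-monoˡ-≤ 1 s≤) ⟩
      ι (suc n * 4 ℕ.^ (m ℕ.+ m) ℕ.+ 1)            <⟨ large ⟩
      (+ 21 ℚ./ 5) ^ (m ℕ.+ m)                     ∎

energy< : ∀ m n (G : Graph (suc n)) → 20 ≤ suc n →
  ι (suc n * 4 ℕ.^ (m ℕ.+ m) ℕ.+ 1) ℚ.< (+ 21 ℚ./ 5) ^ (m ℕ.+ m) →
  edgeCount G ≡ 2 * suc n ∸ 1 → maxDegree G ≤ 4 →
  ∀ E → IsEnergy G E → E <ℝ fromℕ (2 * n)
energy< m n G 20≤n large edges Δ≤4 E (μ , spectrum , E≃) =
  let N₂ , h₂ = powerSum→closedWalks G μ spectrum 2 η (ℚₚ.positive⁻¹ η)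
      N₄ , h₄ = powerSum→closedWalks G μ spectrum 4 η (ℚₚ.positive⁻¹ η)
      N , h   = powerSum→closedWalks G μ spectrum (m ℕ.+ m) 1ℚ (ℚₚ.positive⁻¹ 1ℚ)
      Nₑ , hₑ = _≃_.close E≃ η (ℚₚ.positive⁻¹ η)
  -- η is also the uniform gap that `_<ℝ_` demands.
  in η , ℚₚ.positive⁻¹ η , (N₂ ℕ.⊔ N₄) ℕ.⊔ (N ℕ.⊔ Nₑ) , λ k le →
    let le₁ = ℕₚ.m⊔n≤o⇒m≤o (N₂ ℕ.⊔ N₄) (N ℕ.⊔ Nₑ) le
        le₂ = ℕₚ.m⊔n≤o⇒n≤o (N₂ ℕ.⊔ N₄) (N ℕ.⊔ Nₑ) le
    in approximate-energy {n} {m} {closedWalks 2} {closedWalks 4} {closedWalks (m ℕ.+ m)}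
      (λ i → seq (μ i) k) (seq E k) 20≤n closedWalks₂+2
      (subst (λ s → 13 * s ≤ closedWalks 4 ℕ.+ 24 * suc n) (sym closedWalks₂) closedWalks₄≥)
      (closedWalks≤ Δ≤4 (m ℕ.+ m)) large
      (h₂ k (ℕₚ.m⊔n≤o⇒m≤o N₂ N₄ le₁))
      (h₄ k (ℕₚ.m⊔n≤o⇒n≤o N₂ N₄ le₁))
      (h k (ℕₚ.m⊔n≤o⇒m≤o N Nₑ le₂))
      (subst (λ t → ℚ.∣ seq E k ℚ.- t ∣ ℚ.< η) (seq-sum (λ i → absℝ (μ i)) k)
        (hₑ k (ℕₚ.m⊔n≤o⇒n≤o N Nₑ le₂)))
  where
  open Walks G
  closedWalks₂+2 : closedWalks 2 ℕ.+ 2 ≡ 4 * suc n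
  closedWalks₂+2 = trans
    (cong (ℕ._+ 2) (trans closedWalks₂ (trans handshake (cong (2 *_) edges))))
    -- `2 * suc n ∸ 1` computes to n + (1 + n + 0), so the solver meets no truncated subtraction.
    (solve 1 (λ n → con 2 :* (n :+ (con 1 :+ n :+ con 0)) :+ con 2 := con 4 :* (con 1 :+ n)) refl n)
    where open ℕ-Solver

theorem3p2 : ∀ (n : ℕ) → n ≡ 20 ⊎ n ≡ 21 →
    (G : Graph n) → edgeCount G ≡ 2 * n ∸ 1 → maxDegree G ≤ 4 →
    ∀ (E : ℝ) → IsEnergy G E → E <ℝ fromℕ (2 * (n ∸ 1))
theorem3p2 zero    (inj₁ ())
theorem3p2 zero    (inj₂ ())
-- 32 is the least m that makes (21/20)^(2m) exceed 21: the value is about 22.7, against 20.6 for m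
-- = 31.
theorem3p2 (suc n) n≡ G = energy< 32 n G (20≤ n≡) (large (suc n) n≡)
  where
  20≤ : ∀ {n} → n ≡ 20 ⊎ n ≡ 21 → 20 ≤ n
  20≤ (inj₁ refl) = ℕₚ.≤-refl
  20≤ (inj₂ refl) = ℕₚ.n≤1+n 20
  large : ∀ n → n ≡ 20 ⊎ n ≡ 21 → ι (n * 4 ℕ.^ (32 ℕ.+ 32) ℕ.+ 1) ℚ.< (+ 21 ℚ./ 5) ^ (32 ℕ.+ 32)
  large n (inj₁ refl) = from-yes (ι (20 * 4 ℕ.^ (32 ℕ.+ 32) ℕ.+ 1) ℚₚ.<? (+ 21 ℚ./ 5) ^ (32 ℕ.+ 32))
  large n (inj₂ refl) = from-yes (ι (21 * 4 ℕ.^ (32 ℕ.+ 32) ℕ.+ 1) ℚₚ.<? (+ 21 ℚ./ 5) ^ (32 ℕ.+ 32))
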